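{- If there exists a demi-bits generator $G=\{G_n:\{0,1\}^n\to\{0,1\}^{10n}\}_{n}$ (secure against nondeterministic polynomial-size circuits), then the range avoidance problem $\textsc{Avoid}$ is not in $\mathbf{SearchNP}$.
   Context: Range avoidance ($\textsc{Avoid}$): given a Boolean circuit $C:\{0,1\}^n\to\{0,1\}^m$ with $m>n$, output some $y\in\{0,1\}^m$ with $y\notin\mathrm{Range}(C)$. A search problem is in $\mathbf{SearchNP}$ if there is a nondeterministic polynomial-time Turing machine $M$ such that on every input $x$: if $x$ has a solution then $M(x)$ has at least one accepting computation path and every accepting path outputs a valid solution; if $x$ has no solution then $M(x)$ has no accepting path. Demi-bits generator: a family of functions $G_n:\{0,1\}^n\to\{0,1\}^{N(n)}$ with $N(n)>n$, computable by polynomial-size (possibly non-uniform) circuits. A (nondeterministic) adversary $D$ breaks $G$ at length $n$ if $\Pr_{y\sim\{0,1\}^{N}}[D(y)=1]\ge 1/3$ while $D(G_n(x))=0$ for every $x\in\{0,1\}^n$. $G$ is a demi-bits generator (secure against $\mathbf{NP}/\mathrm{poly}$) if every family of polynomial-size nondeterministic circuits breaks $G$ at only finitely many lengths $n$. -}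

module Defs where

open import Data.Nat using (ℕ; zero; suc; _+_; _*_; _^_; _≤_; _<_)
open import Data.Nat.Binary as B using (ℕᵇ)
open import Data.Bool using (Bool; true; false; _∧_; _∨_; not; if_then_else_)
open import Data.Fin as F using (Fin; toℕ)
open import Data.Fin.Properties using () renaming (_≟_ to _≟F_)
open import Data.List using (List; []; _∷_; _++_; length; concatMap; filter)
open import Data.List.Relation.Unary.Any using () 
open import Data.Vec as V using (Vec; lookup; _∷ʳ_; toList)
open import Data.Product using (Σ; ∃; _×_; _,_; proj₁)
open import Relation.Binary.PropositionalEquality using (_≡_; _≢_)
open import Relation.Nullary using (¬_; does)

data Gate (w : ℕ) : Set where
  andG : Fin w → Fin w → Gate w
  orG  : Fin w → Fin w → Gate w
  notG : Fin w → Gate w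

-- Gates n w : a sequence of gates starting from n input wires and
-- ending with w wires in total (snoc-list; each new gate adds a wire).
data Gates (n : ℕ) : ℕ → Set where
  []  : Gates n n
  _▷_ : ∀ {w} → Gates n w → Gate w → Gates n (suc w)

record Circuit (n m : ℕ) : Set where
  constructor circuit
  field
    wires : ℕ
    gates : Gates n wires
    outs  : Vec (Fin wires) m

open Circuit public

evalGate : ∀ {w} → Gate w → Vec Bool w → Bool
evalGate (andG i j) v = lookup v i ∧ lookup v j
evalGate (orG i j)  v = lookup v i ∨ lookup v j
evalGate (notG i)   v = not (lookup v i)

evalGates : ∀ {n w} → Gates n w → Vec Bool n → Vec Bool w
evalGates []       x = x
evalGates (gs ▷ g) x = let u = evalGates gs x in u ∷ʳ evalGate g u

eval : ∀ {n m} → Circuit n m → Vec Bool n → Vec Bool m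
eval C x = V.map (lookup (evalGates (gates C) x)) (outs C)

gateCount : ∀ {n w} → Gates n w → ℕ
gateCount []       = 0
gateCount (gs ▷ g) = suc (gateCount gs)

size : ∀ {n m} → Circuit n m → ℕ
size {n} {m} C = n + gateCount (gates C) + m

InRange : ∀ {n m} → Circuit n m → Vec Bool m → Set
InRange C y = ∃ λ x → eval C x ≡ y

allVecs : (k : ℕ) → List (Vec Bool k)
allVecs zero    = V.[] ∷ []
allVecs (suc k) = concatMap (λ v → (false V.∷ v) ∷ (true V.∷ v) ∷ []) (allVecs k)

anyL : ∀ {A : Set} → (A → Bool) → List A → Bool
anyL p []       = false
anyL p (a ∷ as) = p a ∨ anyL p as

countL : ∀ {A : Set} → (A → Bool) → List A → ℕ
countL p []       = 0
countL p (a ∷ as) = (if p a then 1 else 0) + countL p as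

record NCircuit (N : ℕ) : Set where
  constructor ncircuit
  field
    witLen : ℕ
    body   : Circuit (N + witLen) 1

open NCircuit public

accepts : ∀ {N} → NCircuit N → Vec Bool N → Bool
accepts D y = anyL (λ w → V.head (eval (body D) (y V.++ w))) (allVecs (witLen D))

nsize : ∀ {N} → NCircuit N → ℕ
nsize D = size (body D)

PolyBounded : (ℕ → ℕ) → Set
PolyBounded f = ∃ λ c → ∀ n → f n ≤ c * n ^ c + c

-- D breaks the generator Gn (at length n):
-- Pr_y[D(y)=1] ≥ 1/3 and D(Gn(x)) = 0 for all x.
Breaks : ∀ {n N} → Circuit n N → NCircuit N → Set
Breaks {n} {N} Gn D =
  (2 ^ N ≤ 3 * countL (accepts D) (allVecs N))
  × (∀ (x : Vec Bool n) → accepts D (eval Gn x) ≡ false)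

DemiBitsGenerator : ((n : ℕ) → Circuit n (10 * n)) → Set
DemiBitsGenerator G =
  PolyBounded (λ n → size (G n))
  × (∀ (D : (N : ℕ) → NCircuit N) → PolyBounded (λ N → nsize (D N))
       → ∃ λ n₀ → ∀ n → n₀ ≤ n → ¬ Breaks (G n) (D (10 * n)))

-- Binary encoding of circuits (prefix-free, polynomially succinct)

encℕᵇ : ℕᵇ → List Bool
encℕᵇ ℕᵇ.zero     = false ∷ false ∷ []
encℕᵇ (ℕᵇ.2[1+ x ]) = true ∷ false ∷ encℕᵇ x
encℕᵇ (ℕᵇ.1+[2 x ]) = true ∷ true ∷ encℕᵇ x

encℕ : ℕ → List Bool
encℕ n = encℕᵇ (B.fromℕ n)

encFin : ∀ {k} → Fin k → List Bool
encFin i = encℕ (toℕ i)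

encGate : ∀ {w} → Gate w → List Bool
encGate (andG i j) = false ∷ false ∷ encFin i ++ encFin j
encGate (orG i j)  = false ∷ true ∷ encFin i ++ encFin j
encGate (notG i)   = true ∷ false ∷ encFin i

encGates : ∀ {n w} → Gates n w → List Bool
encGates []       = false ∷ []
encGates (gs ▷ g) = true ∷ encGate g ++ encGates gs

encOuts : ∀ {w m} → Vec (Fin w) m → List Bool
encOuts V.[]       = []
encOuts (i V.∷ is) = encFin i ++ encOuts is

encCircuit : ∀ {n m} → Circuit n m → List Bool
encCircuit {n} {m} C =
  encℕ n ++ encℕ m ++ encℕ (wires C) ++ encGates (gates C) ++ encOuts (outs C)

data Move : Set where
  left right stay : Move

record NTM : Set where
  field
    states   : ℕ
    extra    : ℕ
    start    : Fin states
    acceptSt : Fin states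
    rejectSt : Fin states
    -- transition, given the current state, scanned symbol and a
    -- nondeterministic guess bit
    δ : Fin states → Fin (3 + extra) → Bool
        → Fin states × Fin (3 + extra) × Move

module _ (M : NTM) where
  open NTM M

  Sym : Set
  Sym = Fin (3 + extra)

  blank : Sym
  blank = F.zero

  bitSym : Bool → Sym
  bitSym false = F.suc F.zero
  bitSym true  = F.suc (F.suc F.zero)

  record Config : Set where
    constructor conf
    field
      state : Fin states
      lft   : List Sym   -- cells left of the head, nearest first
      hd    : Sym
      rgt   : List Sym   -- cells right of the head, nearest first

  halted : Config → Bool
  halted c = does (Config.state c ≟F acceptSt) ∨ does (Config.state c ≟F rejectSt)

  moveHead : Move → List Sym → Sym → List Sym → List Sym × Sym × List Sym
  moveHead left  []       h r = [] , blank , h ∷ r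
  moveHead left  (a ∷ l)  h r = l , a , h ∷ r
  moveHead right l h []       = h ∷ l , blank , []
  moveHead right l h (a ∷ r)  = h ∷ l , a , r
  moveHead stay  l h r        = l , h , r

  step : Config → Bool → Config
  step (conf q l h r) b with δ q h b
  ... | q' , s , mv with moveHead mv l s r
  ...   | l' , h' , r' = conf q' l' h' r'

  exec : Config → List Bool → Config
  exec c []       = c
  exec c (b ∷ bs) = if halted c then c else exec (step c b) bs

  initConf : List Bool → Config
  initConf []       = conf start [] blank []
  initConf (b ∷ bs) = conf start [] (bitSym b) (Data.List.map bitSym bs)

  symBit : Sym → List Bool → List Bool
  symBit (F.suc F.zero)          k = false ∷ k
  symBit (F.suc (F.suc F.zero))  k = true ∷ k
  symBit _                       k = []

  readBits : List Sym → List Bool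
  readBits []      = []
  readBits (s ∷ r) = symBit s (readBits r)

  output : Config → List Bool
  output (conf q l h r) = readBits (h ∷ r)

  AcceptsPath : List Bool → List Bool → Set
  AcceptsPath x g = Config.state (exec (initConf x) g) ≡ acceptSt

  PathOutput : List Bool → List Bool → List Bool
  PathOutput x g = output (exec (initConf x) g)

  PolyTime : Set
  PolyTime = ∃ λ c → ∀ (x g : List Bool) → length g ≡ c * length x ^ c + c
             → halted (exec (initConf x) g) ≡ true

AvoidSolution : ∀ {n m} → Circuit n m → List Bool → Set
AvoidSolution {n} {m} C y = Σ (Vec Bool m) λ v → (toList v ≡ y) × ¬ InRange C v

AvoidInSearchNP : Set
AvoidInSearchNP =
  Σ NTM λ M → PolyTime M
    × (∀ (n m : ℕ) (C : Circuit n m) → n < m →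
         (∃ λ g → AcceptsPath M (encCircuit C) g)
         × (∀ g → AcceptsPath M (encCircuit C) g
                → AvoidSolution C (PathOutput M (encCircuit C) g)))

{-# OPTIONS --safe #-}
module Submission where

-- Let M solve Avoid nondeterministically. For k = 7n strings s₁, …, s_k of length N = 10n there is a small
-- circuit C_s with 8n + 2 < N inputs whose range contains G(x) ⊕ s_j for all x and j. If M outputs z on C_s,
-- then no z ⊕ s_j lies in the range of G. The adversary guesses s, j and a computation path of M on C_s,
-- and accepts y if M accepts with an output z satisfying y = z ⊕ s_j; so it rejects the range of G.
-- If it accepted a set A of less than a third of all y, then, averaging over s_j, each further shift could
-- be chosen so as to leave at most a third of the z with z ⊕ s₁, …, z ⊕ s_j in A. As 2 ^ N < 3 ^ k, some s
-- leaves no z at all, although M has an output z on C_s, and A contains all z ⊕ s_j.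

-- The adversary is a circuit that has to run `M` on the code of C_s for a guessed s, so that code
-- must be available as wires. It is not computed: C_s is designed so that s affects nothing but the
-- kinds of k * N gates, and the code becomes a fixed template with the guessed bits of s as
-- variables. A simulation of `M` on partly variable input then needs only a table lookup per step.
--
-- The gate basis has no constants, so C_s spends two inputs on false and true; besides these it has
-- n seed bits and k selector bits, one for each shift, hence 8n + 2 inputs. The constant 7 has to
-- satisfy two demands: 3 ^ k > 2 ^ N needs k above 10n times the base-3 logarithm of 2, about
-- 6.31n, while C_s stretches its input only if n + k + 2 < 10n.
--
-- Soundness holds for every selector pattern, one-hot or not, because C_s and the final comparison
-- of the adversary use the same combination of shifts. The witness therefore undergoes no check at
-- all.

open import Defs
open import Data.Bool using (Bool; true; false; _∧_; _∨_; not; if_then_else_; _xor_)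
open import Data.Bool.Properties using (∨-identityʳ; ∧-identityʳ; ∨-assoc; ∧-assoc; ∨-zeroʳ; ¬-not)
open import Data.Empty using (⊥)
open import Data.Fin using (Fin; zero; suc; toℕ; fromℕ; fromℕ<; inject₁; combine; remQuot; _↑ˡ_; _↑ʳ_)
open import Data.Fin.Properties using (_≟_; toℕ-fromℕ<; toℕ≤n; +↔⊎; *↔×; remQuot-combine)
open import Data.List as List using (List; []; _∷_; length; drop; take; replicate; map; concatMap; tabulate; _++_)
open import Data.List.Properties using (length-map; length-++; length-take; length-replicate; length-tabulate; map-∘; map-id; map-++; map-tabulate; ++-assoc; take++drop≡id; tabulate-lookup; tabulate-cong; ∷-injective)
open import Data.Nat using (ℕ; zero; suc; _+_; _*_; _^_; _≤_; _<_; z≤n; s≤s; _<?_)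
open import Data.Nat.Binary as ℕᵇ using (2[1+_]; 1+[2_])
open import Data.Nat.Binary.Properties using (toℕ-fromℕ)
open import Data.Nat.DivMod using (_/_; m*n/n≡m; m/n≤m)
open import Data.Nat.Properties hiding (_≟_)
open import Data.Nat.Properties using () renaming (_≟_ to _≟ℕ_)
open import Data.Nat.Tactic.RingSolver using (solve-∀)
open import Data.Product using (∃; _×_; _,_; proj₁; proj₂; uncurry)
open import Data.Sum using (_⊎_; inj₁; inj₂; [_,_]; map₁; map₂)
open import Data.Sum.Function.Propositional using (_⊎-↔_)
open import Data.Unit using (⊤; tt)
open import Data.Vec as Vec using (Vec; []; _∷_; lookup; toList; zipWith; _∷ʳ_)
open import Data.Vec.Properties using (lookup-++ˡ; lookup-++ʳ; lookup-map; lookup-zipWith; lookup∘tabulate; tabulate∘lookup) renaming (tabulate-cong to Vec-tabulate-cong)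
open import Function using (_∘_; id; _↔_; Inverse)
open import Function.Construct.Composition using (_↔-∘_)
open import Function.Construct.Identity using (↔-id)
open import Relation.Binary.PropositionalEquality hiding ([_])
open import Relation.Nullary using (¬_; Dec; does; yes; no; contradiction)
open import Relation.Nullary.Decidable using (dec-true; dec-false)

private variable
  X Y I U V : Set
  a b d k m n r w N : ℕ

-- Circuits as programs with named wires

-- Gates append their wire at the end, while `lookup` peels vectors from the front; this tells the
-- last wire from the earlier ones.
unsnoc : Fin (suc w) → Fin w ⊎ Fin 1
unsnoc {zero}  zero    = inj₂ zero
unsnoc {suc w} zero    = inj₁ zero
unsnoc {suc w} (suc i) = map₁ suc (unsnoc i)

lookup-∷ʳ : (u : Vec X w) (y : X) (i : Fin (suc w)) →
            lookup (u ∷ʳ y) i ≡ [ lookup u , (λ _ → y) ] (unsnoc i)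
lookup-∷ʳ []      y zero    = refl
lookup-∷ʳ (x ∷ u) y zero    = refl
lookup-∷ʳ (x ∷ u) y (suc i) with unsnoc i | lookup-∷ʳ u y i
... | inj₁ _ | eq = eq
... | inj₂ _ | eq = eq

lookup-inject₁ : (u : Vec X w) (y : X) (i : Fin w) → lookup (u ∷ʳ y) (inject₁ i) ≡ lookup u i
lookup-inject₁ (x ∷ u) y zero    = refl
lookup-inject₁ (x ∷ u) y (suc i) = lookup-inject₁ u y i

lookup-last : (u : Vec X w) (y : X) → lookup (u ∷ʳ y) (fromℕ w) ≡ y
lookup-last []      y = refl
lookup-last (x ∷ u) y = lookup-last u y

infixl 5 _⋙_

_⋙_ : Gates a b → Gates b d → Gates a d
gs ⋙ []       = gs
gs ⋙ (hs ▷ g) = (gs ⋙ hs) ▷ g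

keep : Gates a b → Fin a → Fin b
keep []       i = i
keep (gs ▷ g) i = inject₁ (keep gs i)

evalGates-⋙ : (gs : Gates a b) (hs : Gates b d) (x : Vec Bool a) →
              evalGates (gs ⋙ hs) x ≡ evalGates hs (evalGates gs x)
evalGates-⋙ gs []       x = refl
evalGates-⋙ gs (hs ▷ g) x = cong (λ u → u ∷ʳ evalGate g u) (evalGates-⋙ gs hs x)

gateCount-⋙ : (gs : Gates a b) (hs : Gates b d) → gateCount (gs ⋙ hs) ≡ gateCount gs + gateCount hs
gateCount-⋙ gs []       = sym (+-identityʳ _)
gateCount-⋙ gs (hs ▷ g) = trans (cong suc (gateCount-⋙ gs hs)) (sym (+-suc _ _))

wires-count : (gs : Gates a b) → b ≡ a + gateCount gs
wires-count []       = sym (+-identityʳ _)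
wires-count (gs ▷ g) = trans (cong suc (wires-count gs)) (sym (+-suc _ _))

lookup-keep : (gs : Gates a b) (x : Vec Bool a) (i : Fin a) →
              lookup (evalGates gs x) (keep gs i) ≡ lookup x i
lookup-keep []       x i = refl
lookup-keep (gs ▷ g) x i = trans (lookup-inject₁ (evalGates gs x) _ (keep gs i)) (lookup-keep gs x i)

-- The Boolean parameter of a junction selects disjunction (true) or conjunction (false), as in encGate.
junction : Bool → Fin w → Fin w → Gate w
junction false = andG
junction true  = orG

connect : Bool → Bool → Bool → Bool
connect false = _∧_
connect true  = _∨_

evalGate-junction : ∀ β (i j : Fin w) (u : Vec Bool w) → evalGate (junction β i j) u ≡ connect β (lookup u i) (lookup u j)
evalGate-junction false i j u = refl
evalGate-junction true  i j u = refl

-- Formulas and their compilation into gates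

data Formula (V : Set) : Set where
  lit : Bool ⊎ V → Formula V
  bin : Bool → Formula V → Formula V → Formula V
  neg : Formula V → Formula V

pattern const β = lit (inj₁ β)
pattern var v   = lit (inj₂ v)

infixr 6 _∧ᶠ_
infixr 5 _∨ᶠ_

_∧ᶠ_ _∨ᶠ_ : Formula V → Formula V → Formula V
_∧ᶠ_ = bin false
_∨ᶠ_ = bin true

⟦_⟧ : Formula V → (V → Bool) → Bool
⟦ lit l ⟧     ρ = [ id , ρ ] l
⟦ bin β φ ψ ⟧ ρ = connect β (⟦ φ ⟧ ρ) (⟦ ψ ⟧ ρ)
⟦ neg φ ⟧     ρ = not (⟦ φ ⟧ ρ)

cost : Formula V → ℕ
cost (lit _)     = 0
cost (bin _ φ ψ) = suc (cost φ + cost ψ)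
cost (neg φ)     = suc (cost φ)

-- Wires are addressed through an arbitrary type of names, so that structured data such as the cells
-- of a configuration can label them directly and renaming adds no gates.
record Program (n : ℕ) (V : Set) : Set where
  constructor program
  field
    {width} : ℕ
    code    : Gates n width
    wire    : V → Fin width

open Program public

gatesOf : Program n V → ℕ
gatesOf P = gateCount (code P)

run : Program n V → Vec Bool n → V → Bool
run P x v = lookup (evalGates (code P) x) (wire P v)

-- There are no constant gates, so `κ` supplies wires that are known to carry the two constants.
emit : (V → Fin w) → Formula V → (Bool → Fin w) → Program w ⊤
emit σ (const β)   κ = program [] (λ _ → κ β)
emit σ (var v)     κ = program [] (λ _ → σ v)
emit σ (bin β φ ψ) κ =
  let P = emit σ φ κ
      Q = emit (keep (code P) ∘ σ) ψ (keep (code P) ∘ κ)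
  in program ((code P ⋙ code Q) ▷ junction β (keep (code Q) (wire P tt)) (wire Q tt)) (λ _ → fromℕ _)
emit σ (neg φ)     κ =
  let P = emit σ φ κ
  in program (code P ▷ notG (wire P tt)) (λ _ → fromℕ _)

emit-run : ∀ (σ : V → Fin w) φ κ u {ρ} → (∀ v → lookup u (σ v) ≡ ρ v) → (∀ β → lookup u (κ β) ≡ β) →
           run (emit σ φ κ) u tt ≡ ⟦ φ ⟧ ρ
emit-run σ (const β) κ u σ-ok κ-ok = κ-ok β
emit-run σ (var v)   κ u σ-ok κ-ok = σ-ok v
emit-run σ (bin β φ ψ) κ u σ-ok κ-ok =
  let P  = emit σ φ κ
      Q  = emit (keep (code P) ∘ σ) ψ (keep (code P) ∘ κ)
      u₁ = evalGates (code P) u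
      split = evalGates-⋙ (code P) (code Q) u
  in trans (lookup-last (evalGates (code P ⋙ code Q) u) _)
    (trans (evalGate-junction β _ _ _)
      (cong₂ (connect β)
        (trans (cong (λ t → lookup t (keep (code Q) (wire P tt))) split)
          (trans (lookup-keep (code Q) u₁ (wire P tt)) (emit-run σ φ κ u σ-ok κ-ok)))
        (trans (cong (λ t → lookup t (wire Q tt)) split)
          (emit-run _ ψ _ u₁
            (λ v → trans (lookup-keep (code P) u (σ v)) (σ-ok v))
            (λ γ → trans (lookup-keep (code P) u (κ γ)) (κ-ok γ))))))
emit-run σ (neg φ) κ u σ-ok κ-ok =
  trans (lookup-last (evalGates (code (emit σ φ κ)) u) _) (cong not (emit-run σ φ κ u σ-ok κ-ok))

emit-gates : ∀ (σ : V → Fin w) φ κ → gatesOf (emit σ φ κ) ≡ cost φ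
emit-gates σ (const β)   κ = refl
emit-gates σ (var v)     κ = refl
emit-gates σ (bin β φ ψ) κ =
  cong suc (trans (gateCount-⋙ (code (emit σ φ κ)) _) (cong₂ _+_ (emit-gates σ φ κ) (emit-gates _ ψ _)))
emit-gates σ (neg φ)     κ = cong suc (emit-gates σ φ κ)

emitAll : (V → Fin w) → (Fin m → Formula V) → (Bool → Fin w) → Program w (Fin m)
emitAll {m = zero}  σ φ κ = program [] (λ ())
emitAll {m = suc m} σ φ κ =
  let P = emit σ (φ zero) κ
      Q = emitAll (keep (code P) ∘ σ) (φ ∘ suc) (keep (code P) ∘ κ)
  in program (code P ⋙ code Q) (λ { zero → keep (code Q) (wire P tt) ; (suc i) → wire Q i })

emitAll-run : ∀ (σ : V → Fin w) (φ : Fin m → Formula V) κ u {ρ} →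
              (∀ v → lookup u (σ v) ≡ ρ v) → (∀ β → lookup u (κ β) ≡ β) →
              ∀ i → run (emitAll σ φ κ) u i ≡ ⟦ φ i ⟧ ρ
emitAll-run {m = suc m} σ φ κ u σ-ok κ-ok i = trans (cong (λ t → lookup t _) split) (go i)
  where
  P  = emit σ (φ zero) κ
  Q  = emitAll (keep (code P) ∘ σ) (φ ∘ suc) (keep (code P) ∘ κ)
  u₁ = evalGates (code P) u
  split = evalGates-⋙ (code P) (code Q) u
  go : ∀ i → lookup (evalGates (code Q) u₁) (wire (emitAll σ φ κ) i) ≡ ⟦ φ i ⟧ _
  go zero    = trans (lookup-keep (code Q) u₁ (wire P tt)) (emit-run σ (φ zero) κ u σ-ok κ-ok)
  go (suc i) = emitAll-run _ (φ ∘ suc) _ u₁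
                 (λ v → trans (lookup-keep (code P) u (σ v)) (σ-ok v))
                 (λ γ → trans (lookup-keep (code P) u (κ γ)) (κ-ok γ)) i

emitAll-gates : ∀ (σ : V → Fin w) (φ : Fin m → Formula V) κ {s} → (∀ i → cost (φ i) ≤ s) →
                gatesOf (emitAll σ φ κ) ≤ m * s
emitAll-gates {m = zero}  σ φ κ bound = z≤n
emitAll-gates {m = suc m} σ φ κ bound =
  ≤-trans (≤-reflexive (gateCount-⋙ (code (emit σ (φ zero) κ)) _))
    (+-mono-≤ (≤-trans (≤-reflexive (emit-gates σ (φ zero) κ)) (bound zero))
              (emitAll-gates _ (φ ∘ suc) _ (bound ∘ suc)))

-- A program over Bool ⊎ V has constant wires besides those for V.
Yields : Program n (Bool ⊎ V) → Vec Bool n → (V → Bool) → Set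
Yields P x ρ = ∀ l → run P x l ≡ [ id , ρ ] l

Yields-≗ : ∀ {P : Program n (Bool ⊎ V)} {x ρ ρ′} → ρ ≗ ρ′ → Yields P x ρ → Yields P x ρ′
Yields-≗ eq ok (inj₁ β) = ok (inj₁ β)
Yields-≗ eq ok (inj₂ v) = trans (ok (inj₂ v)) (eq v)

relabel : (V → U) → Program n (Bool ⊎ U) → Program n (Bool ⊎ V)
relabel f P = program (code P) (wire P ∘ map₂ f)

relabel-yields : ∀ (f : V → U) {P : Program n (Bool ⊎ U)} {x ρ} → Yields P x ρ → Yields (relabel f P) x (ρ ∘ f)
relabel-yields f ok (inj₁ β) = ok (inj₁ β)
relabel-yields f ok (inj₂ v) = ok (inj₂ (f v))

-- All new formulas read the wires of `P` and never each other, so this is a simultaneous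
-- assignment. The enumeration `e` only fixes the order in which they are compiled.
extend : Fin m ↔ U → (U → Formula V) → Program n (Bool ⊎ V) → Program n (Bool ⊎ (V ⊎ U))
extend e φ P =
  let Q = emitAll (wire P ∘ inj₂) (φ ∘ Inverse.to e) (wire P ∘ inj₁)
  in program (code P ⋙ code Q)
       [ keep (code Q) ∘ wire P ∘ inj₁ , [ keep (code Q) ∘ wire P ∘ inj₂ , wire Q ∘ Inverse.from e ] ]

extend-yields : ∀ (e : Fin m ↔ U) (φ : U → Formula V) (P : Program n (Bool ⊎ V)) {x ρ} →
                Yields P x ρ → Yields (extend e φ P) x [ ρ , (λ u → ⟦ φ u ⟧ ρ) ]
extend-yields e φ P {x} {ρ} ok l = trans (cong (λ t → lookup t (wire (extend e φ P) l)) (evalGates-⋙ (code P) (code Q) x)) (go l)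
  where
  Q = emitAll (wire P ∘ inj₂) (φ ∘ Inverse.to e) (wire P ∘ inj₁)
  u = evalGates (code P) x
  go : ∀ l → lookup (evalGates (code Q) u) (wire (extend e φ P) l) ≡ [ id , [ ρ , (λ u → ⟦ φ u ⟧ ρ) ] ] l
  go (inj₁ β)        = trans (lookup-keep (code Q) u _) (ok (inj₁ β))
  go (inj₂ (inj₁ v)) = trans (lookup-keep (code Q) u _) (ok (inj₂ v))
  go (inj₂ (inj₂ y)) =
    trans (emitAll-run _ (φ ∘ Inverse.to e) _ u (ok ∘ inj₂) (ok ∘ inj₁) (Inverse.from e y))
          (cong (λ z → ⟦ φ z ⟧ ρ) (Inverse.strictlyInverseˡ e y))

extend-gates : ∀ (e : Fin m ↔ U) (φ : U → Formula V) (P : Program n (Bool ⊎ V)) {s} → (∀ u → cost (φ u) ≤ s) →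
               gatesOf (extend e φ P) ≤ gatesOf P + m * s
extend-gates e φ P bound =
  ≤-trans (≤-reflexive (gateCount-⋙ (code P) _))
    (+-monoʳ-≤ (gatesOf P)
      (emitAll-gates (wire P ∘ inj₂) (φ ∘ Inverse.to e) (wire P ∘ inj₁) (bound ∘ Inverse.to e)))

-- With t the value of an arbitrary input wire `d`, the constants arise as t ∧ not t and t ∨ not t.
-- This requires at least one input.
inputs : Fin n → Program n (Bool ⊎ Fin n)
inputs {n} d = program code₃ [ constant , keep code₃ ]
  where
  code₁ : Gates n (1 + n)
  code₂ : Gates n (2 + n)
  code₃ : Gates n (3 + n)
  code₁ = [] ▷ notG d
  code₂ = code₁ ▷ andG (inject₁ d) (fromℕ _)
  code₃ = code₂ ▷ orG (inject₁ (inject₁ d)) (inject₁ (fromℕ _))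
  constant : Bool → Fin (3 + n)
  constant false = inject₁ (fromℕ _)
  constant true  = fromℕ _

inputs-yields : (d : Fin n) (x : Vec Bool n) → Yields (inputs d) x (lookup x)
inputs-yields d x = ok
  where
  t = lookup x d
  x₁ = x ∷ʳ not t
  excluded : ∀ t → t ∧ not t ≡ false
  excluded false = refl
  excluded true  = refl
  middle : ∀ t → t ∨ not t ≡ true
  middle false = refl
  middle true  = refl
  second : evalGate (andG (inject₁ d) (fromℕ _)) x₁ ≡ false
  second = trans (cong₂ _∧_ (lookup-inject₁ x _ d) (lookup-last x _)) (excluded t)
  ok : Yields (inputs d) x (lookup x)
  ok (inj₁ false) = trans (lookup-inject₁ (x₁ ∷ʳ _) _ (fromℕ _)) (trans (lookup-last x₁ _) second)
  ok (inj₁ true)  = trans (lookup-last (x₁ ∷ʳ _) _)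
    (trans (cong₂ _∨_ (trans (lookup-inject₁ x₁ _ (inject₁ d)) (lookup-inject₁ x _ d))
                      (trans (lookup-inject₁ x₁ _ (fromℕ _)) (lookup-last x _))) (middle t))
  ok (inj₂ i) = lookup-keep (code (inputs d)) x i

gateFormula : Gate w → Formula (V ⊎ Fin w)
gateFormula (andG i j) = var (inj₂ i) ∧ᶠ var (inj₂ j)
gateFormula (orG i j)  = var (inj₂ i) ∨ᶠ var (inj₂ j)
gateFormula (notG i)   = neg (var (inj₂ i))

evalGate-formula : ∀ (g : Gate w) u (ρ : V → Bool) → ⟦ gateFormula g ⟧ [ ρ , lookup u ] ≡ evalGate g u
evalGate-formula (andG i j) u ρ = refl
evalGate-formula (orG i j)  u ρ = refl
evalGate-formula (notG i)   u ρ = refl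

cost-gateFormula : (g : Gate w) → cost (gateFormula {V = V} g) ≤ 1
cost-gateFormula (andG i j) = ≤-refl
cost-gateFormula (orG i j)  = ≤-refl
cost-gateFormula (notG i)   = ≤-refl

attach : V ⊎ Fin (suc w) → (V ⊎ Fin w) ⊎ Fin 1
attach (inj₁ v) = inj₁ (inj₁ v)
attach (inj₂ i) = map₁ inj₂ (unsnoc i)

-- Inlines a given circuit at one gate per gate: its inputs are identified with existing wires by
-- `ι`, and all its wires become names.
simulate : (Fin m → V) → Gates m w → Program n (Bool ⊎ V) → Program n (Bool ⊎ (V ⊎ Fin w))
simulate ι []       P = relabel [ id , ι ] P
simulate ι (gs ▷ g) P = relabel attach (extend (↔-id _) (λ _ → gateFormula g) (simulate ι gs P))

simulate-yields : ∀ (ι : Fin m → V) (gs : Gates m w) (P : Program n (Bool ⊎ V)) {x ρ} z →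
                  (∀ i → ρ (ι i) ≡ lookup z i) →
                  Yields P x ρ → Yields (simulate ι gs P) x [ ρ , lookup (evalGates gs z) ]
simulate-yields ι [] P {ρ = ρ} z z-ok ok =
  Yields-≗ {P = relabel _ P} (λ { (inj₁ v) → refl ; (inj₂ i) → z-ok i }) (relabel-yields [ id , ι ] {P = P} ok)
simulate-yields ι (gs ▷ g) P {ρ = ρ} z z-ok ok =
  Yields-≗ {P = relabel attach Q} eq
    (relabel-yields attach {P = Q}
      (extend-yields (↔-id _) (λ _ → gateFormula g) (simulate ι gs P) (simulate-yields ι gs P z z-ok ok)))
  where
  Q = extend (↔-id _) (λ _ → gateFormula g) (simulate ι gs P)
  u = evalGates gs z
  old : _ ⊎ Fin 1 → Bool
  old = [ [ ρ , lookup u ] , (λ _ → ⟦ gateFormula g ⟧ [ ρ , lookup u ]) ]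
  eq : ∀ y → old (attach y) ≡ [ ρ , lookup (u ∷ʳ evalGate g u) ] y
  eq (inj₁ v) = refl
  eq (inj₂ i) with unsnoc i | lookup-∷ʳ u (evalGate g u) i
  ... | inj₁ j | e = sym e
  ... | inj₂ j | e = trans (evalGate-formula g u ρ) (sym e)

simulate-gates : ∀ (ι : Fin m → V) (gs : Gates m w) (P : Program n (Bool ⊎ V)) →
                 gatesOf (simulate ι gs P) ≤ gatesOf P + gateCount gs
simulate-gates ι []       P = m≤m+n _ 0
simulate-gates ι (gs ▷ g) P = ≤-trans
  (extend-gates (↔-id (Fin 1)) (λ _ → gateFormula g) (simulate ι gs P) (λ _ → cost-gateFormula g))
  (≤-trans (+-monoˡ-≤ 1 (simulate-gates ι gs P))
    (≤-reflexive (trans (+-assoc (gatesOf P) (gateCount gs) 1)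
      (cong (gatesOf P +_) (+-comm (gateCount gs) 1)))))

-- One step of a Turing machine

reduce : Bool → (Fin m → Bool) → Bool
reduce {zero}  β f = not β
reduce {suc m} β f = connect β (f zero) (reduce β (f ∘ suc))

reduce-cong : ∀ β {f g : Fin m → Bool} → f ≗ g → reduce β f ≡ reduce β g
reduce-cong {zero}  β eq = refl
reduce-cong {suc m} β eq = cong₂ (connect β) (eq zero) (reduce-cong β (eq ∘ suc))

reduce-∨-false : {f : Fin m → Bool} → (∀ i → f i ≡ false) → reduce true f ≡ false
reduce-∨-false {zero}  f≡false = refl
reduce-∨-false {suc m} f≡false = cong₂ _∨_ (f≡false zero) (reduce-∨-false (f≡false ∘ suc))

reduce-one-hot : ∀ {f : Fin m → Bool} i₀ → (∀ i → i ≢ i₀ → f i ≡ false) → reduce true f ≡ f i₀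
reduce-one-hot {f = f} zero other =
  trans (cong (f zero ∨_) (reduce-∨-false (λ i → other (suc i) λ ()))) (∨-identityʳ _)
reduce-one-hot {f = f} (suc i₀) other =
  cong₂ _∨_ (other zero λ ()) (reduce-one-hot i₀ (λ i i≢ → other (suc i) λ { refl → i≢ refl }))

reduce-at : ∀ (i₀ : Fin m) (f : Fin m → Bool) → reduce true (λ i → does (i ≟ i₀) ∧ f i) ≡ f i₀
reduce-at i₀ f = trans (reduce-one-hot i₀ (λ i i≢ → cong (_∧ f i) (dec-false (i ≟ i₀) i≢)))
                       (cong (_∧ f i₀) (dec-true (i₀ ≟ i₀) refl))

reduce-∧⁺ : {f : Fin m → Bool} → (∀ i → f i ≡ true) → reduce false f ≡ true
reduce-∧⁺ {zero}  all = refl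
reduce-∧⁺ {suc m} all = cong₂ _∧_ (all zero) (reduce-∧⁺ (all ∘ suc))

reduce-∧⁻ : {f : Fin m → Bool} → reduce false f ≡ true → ∀ i → f i ≡ true
reduce-∧⁻ {suc m} {f} eq i with f zero in eq₀
reduce-∧⁻ {suc m} {f} eq zero    | true = eq₀
reduce-∧⁻ {suc m} {f} eq (suc i) | true = reduce-∧⁻ eq i

big : Bool → (Fin m → Formula V) → Formula V
big {zero}  β φ = const (not β)
big {suc m} β φ = bin β (φ zero) (big β (φ ∘ suc))

⟦big⟧ : ∀ β (φ : Fin m → Formula V) ρ → ⟦ big β φ ⟧ ρ ≡ reduce β (λ i → ⟦ φ i ⟧ ρ)
⟦big⟧ {zero}  β φ ρ = refl
⟦big⟧ {suc m} β φ ρ = cong (connect β _) (⟦big⟧ β (φ ∘ suc) ρ)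

big-cost : ∀ β (φ : Fin m → Formula V) {s} → (∀ i → cost (φ i) ≤ s) → cost (big β φ) ≤ m * suc s
big-cost {zero}  β φ bound = z≤n
big-cost {suc m} β φ bound = s≤s (+-mono-≤ (bound zero) (big-cost β (φ ∘ suc) (bound ∘ suc)))

infixl 6 _⊕ᶠ_

_⊕ᶠ_ : Formula V → Formula V → Formula V
φ ⊕ᶠ ψ = (φ ∧ᶠ neg ψ) ∨ᶠ (neg φ ∧ᶠ ψ)

case : Formula V → (Bool → Formula V) → Formula V
case γ φ = (γ ∧ᶠ φ true) ∨ᶠ (neg γ ∧ᶠ φ false)

⟦case⟧ : ∀ (γ : Formula V) φ ρ → ⟦ case γ φ ⟧ ρ ≡ ⟦ φ (⟦ γ ⟧ ρ) ⟧ ρ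
⟦case⟧ γ φ ρ with ⟦ γ ⟧ ρ
... | false = refl
... | true  = ∨-identityʳ _

-- σ i and τ j are meant to be one-hot indicators of a position, at which the table is read.
lookupTable : (Fin m → V) → (Fin n → V) → V → (Fin m → Fin n → Bool → Bool ⊎ V) → Formula V
lookupTable σ τ γ F =
  big true λ i → var (σ i) ∧ᶠ big true λ j → var (τ j) ∧ᶠ case (var γ) λ β → lit (F i j β)

⟦lookupTable⟧ : ∀ (σ : Fin m → V) (τ : Fin n → V) γ F ρ i₀ j₀ →
                (∀ i → ρ (σ i) ≡ does (i ≟ i₀)) → (∀ j → ρ (τ j) ≡ does (j ≟ j₀)) →
                ⟦ lookupTable σ τ γ F ⟧ ρ ≡ [ id , ρ ] (F i₀ j₀ (ρ γ))
⟦lookupTable⟧ σ τ γ F ρ i₀ j₀ σ-hot τ-hot =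
  trans (⟦big⟧ true row ρ)
    (trans (reduce-cong true λ i → cong₂ _∧_ (σ-hot i)
        (trans (⟦big⟧ true (entry i) ρ)
          (trans (reduce-cong true λ j → cong₂ _∧_ (τ-hot j) (⟦case⟧ (var γ) (λ β → lit (F i j β)) ρ))
            (reduce-at j₀ _))))
      (reduce-at i₀ _))
  where
  entry : Fin _ → Fin _ → Formula _
  entry i j = var (τ j) ∧ᶠ case (var γ) λ β → lit (F i j β)
  row : Fin _ → Formula _
  row i = var (σ i) ∧ᶠ big true (entry i)

-- An entry takes four gates for `case` and one for its conjunction with `τ j`; `big` adds one per
-- summand, which gives the 6. Each row adds its conjunction with `σ i` and one gate of the outer
-- `big`.
tableCost : ℕ → ℕ → ℕ
tableCost m n = m * suc (suc (n * 6))

lookupTable-cost : ∀ (σ : Fin m → V) (τ : Fin n → V) γ F → cost (lookupTable σ τ γ F) ≤ tableCost m n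
lookupTable-cost σ τ γ F = big-cost true _ λ i → s≤s (big-cost true _ λ j → ≤-refl)

module Machine (M : NTM) where
  open NTM M

  Letter : Set
  Letter = Fin (3 + extra)

  -- The blank past the end agrees with what `moveHead` scans when it runs off a list, so half-tapes
  -- need only be known cell by cell.
  nth : List Letter → ℕ → Letter
  nth []      j       = blank M
  nth (s ∷ l) zero    = s
  nth (s ∷ l) (suc j) = nth l j

  nth-beyond : ∀ l {j} → length l ≤ j → nth l j ≡ blank M
  nth-beyond []      len       = refl
  nth-beyond (s ∷ l) (s≤s len) = nth-beyond l len

  mirror : Move → Move
  mirror left  = right
  mirror right = left
  mirror stay  = stay

  -- The effect of a move on the half-tape left of the head; the other half sees the mirrored move.
  shift : Move → Letter → List Letter → List Letter
  shift left  s l = drop 1 l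
  shift right s l = s ∷ l
  shift stay  s l = l

  front : Move → List Letter → Letter → List Letter → Letter
  front left  l s r = nth l 0
  front right l s r = nth r 0
  front stay  l s r = s

  moveHead-shift : ∀ mv l s r → moveHead M mv l s r ≡ (shift mv s l , front mv l s r , shift (mirror mv) s r)
  moveHead-shift left  []      s r       = refl
  moveHead-shift left  (a ∷ l) s r       = refl
  moveHead-shift right l       s []      = refl
  moveHead-shift right l       s (a ∷ r) = refl
  moveHead-shift stay  l       s r       = refl

  shifted : Fin states × Letter × Move → Config M → Config M
  shifted (q , s , mv) (conf _ l h r) = conf q (shift mv s l) (front mv l s r) (shift (mirror mv) s r)

  step-shifted : ∀ c β → step M c β ≡ shifted (δ (Config.state c) (Config.hd c) β) c
  step-shifted (conf q l h r) β with δ q h β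
  ... | q′ , s , mv = cong (λ (l′ , h′ , r′) → conf q′ l′ h′ r′) (moveHead-shift mv l s r)

  -- Treating a halted configuration as one that idles turns `exec` into a plain fold over the
  -- guesses, so the simulating program can have a fixed number of steps.
  advance : Config M → Bool → Config M
  advance c β = if halted M c then c else step M c β

  exec-halted : ∀ c bs → halted M c ≡ true → exec M c bs ≡ c
  exec-halted c []       h = refl
  exec-halted c (β ∷ bs) h rewrite h = refl

  exec-∷ : ∀ c β bs → exec M c (β ∷ bs) ≡ exec M (advance c β) bs
  exec-∷ c β bs with halted M c in h
  ... | true  = sym (exec-halted c bs h)
  ... | false = refl

  record Fits (B : ℕ) (c : Config M) : Set where
    constructor fits
    field
      lft-fits : length (Config.lft c) ≤ B
      rgt-fits : length (Config.rgt c) ≤ B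

  length-shift : ∀ mv s l {B} → length l ≤ B → length (shift mv s l) ≤ suc B
  length-shift left  s []      len       = z≤n
  length-shift left  s (x ∷ l) (s≤s len) = m≤n⇒m≤1+n (m≤n⇒m≤1+n len)
  length-shift right s l       len       = s≤s len
  length-shift stay  s l       len       = m≤n⇒m≤1+n len

  advance-fits : ∀ c β {B} → Fits B c → Fits (suc B) (advance c β)
  advance-fits c β {B} (fits len₁ len₂) with halted M c
  ... | true  = fits (m≤n⇒m≤1+n len₁) (m≤n⇒m≤1+n len₂)
  ... | false = subst (Fits (suc B)) (sym (step-shifted c β))
                  (fits (length-shift mv s (Config.lft c) len₁) (length-shift (mirror mv) s (Config.rgt c) len₂))
    where
    s  = proj₁ (proj₂ (δ (Config.state c) (Config.hd c) β))
    mv = proj₂ (proj₂ (δ (Config.state c) (Config.hd c) β))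

  -- A configuration whose half-tapes fit into W cells is described by one-hot bits, relative to the head.
  module Window (W : ℕ) where

    CVar : Set
    CVar = Fin states ⊎ (Letter ⊎ ((Fin W × Letter) ⊎ (Fin W × Letter)))

    pattern st q    = inj₁ q
    pattern scan σ  = inj₂ (inj₁ σ)
    pattern onL i σ = inj₂ (inj₂ (inj₁ (i , σ)))
    pattern onR i σ = inj₂ (inj₂ (inj₂ (i , σ)))

    #CVar : ℕ
    #CVar = states + ((3 + extra) + (W * (3 + extra) + W * (3 + extra)))

    enumeration : Fin #CVar ↔ CVar
    enumeration = (↔-id _ ⊎-↔ ((↔-id _ ⊎-↔ ((*↔× ⊎-↔ *↔×) ↔-∘ +↔⊎)) ↔-∘ +↔⊎)) ↔-∘ +↔⊎

    describe : Config M → CVar → Bool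
    describe c (st q)    = does (q ≟ Config.state c)
    describe c (scan σ)  = does (σ ≟ Config.hd c)
    describe c (onL i σ) = does (σ ≟ nth (Config.lft c) (toℕ i))
    describe c (onR i σ) = does (σ ≟ nth (Config.rgt c) (toℕ i))

    -- `I` names the wires that persist through the simulation, among them the guess bits, whereas
    -- the names in `CVar` move on to the new configuration at every step.
    module _ {I : Set} where

      Lit : Set
      Lit = Bool ⊎ (I ⊎ CVar)

      cell : (Fin W → Letter → CVar) → ℕ → Letter → Lit
      cell t j σ with j <? W
      ... | yes j<W = inj₂ (inj₂ (t (fromℕ< j<W) σ))
      -- Beyond the window a half-tape that fits is blank, so a constant suffices.
      ... | no  _   = inj₁ (does (σ ≟ blank M))

      shiftedCell : (Fin W → Letter → CVar) → Move → Letter → ℕ → Letter → Lit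
      shiftedCell t left  s j       σ = cell t (suc j) σ
      shiftedCell t right s zero    σ = inj₁ (does (σ ≟ s))
      shiftedCell t right s (suc j) σ = cell t j σ
      shiftedCell t stay  s j       σ = cell t j σ

      frontCell : Move → Letter → Letter → Lit
      frontCell left  s σ = cell onL 0 σ
      frontCell right s σ = cell onR 0 σ
      frontCell stay  s σ = inj₁ (does (σ ≟ s))

      moved : Fin states × Letter × Move → CVar → Lit
      moved (q , s , mv) (st p)    = inj₁ (does (p ≟ q))
      moved (q , s , mv) (scan σ)  = frontCell mv s σ
      moved (q , s , mv) (onL i σ) = shiftedCell onL mv s (toℕ i) σ
      moved (q , s , mv) (onR i σ) = shiftedCell onR (mirror mv) s (toℕ i) σ

      halts : Fin states → Bool
      halts q = does (q ≟ acceptSt) ∨ does (q ≟ rejectSt)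

      next : CVar → Fin states → Letter → Bool → Lit
      next u q h β = if halts q then inj₂ (inj₂ u) else moved (δ q h β) u

      stVar : Fin states → I ⊎ CVar
      stVar q = inj₂ (st q)

      scanVar : Letter → I ⊎ CVar
      scanVar σ = inj₂ (scan σ)

      stepFormula : I → CVar → Formula (I ⊎ CVar)
      stepFormula γ u = lookupTable stVar scanVar (inj₁ γ) (next u)

      module _ (ρ : I → Bool) (c : Config M) (c-fits : Fits W c) where
        open Config c
        open Fits c-fits

        env : I ⊎ CVar → Bool
        env = [ ρ , describe c ]

        cell-correct : ∀ t l → length l ≤ W → (∀ i σ → describe c (t i σ) ≡ does (σ ≟ nth l (toℕ i))) →
                       ∀ j σ → [ id , env ] (cell t j σ) ≡ does (σ ≟ nth l j)
        cell-correct t l len t-ok j σ with j <? W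
        ... | yes j<W = trans (t-ok _ σ) (cong (λ i → does (σ ≟ nth l i)) (toℕ-fromℕ< j<W))
        ... | no  j≮W = cong (λ s → does (σ ≟ s)) (sym (nth-beyond l (≤-trans len (≮⇒≥ j≮W))))

        shiftedCell-correct : ∀ t l → length l ≤ W → (∀ i σ → describe c (t i σ) ≡ does (σ ≟ nth l (toℕ i))) →
                              ∀ mv s j σ → [ id , env ] (shiftedCell t mv s j σ) ≡ does (σ ≟ nth (shift mv s l) j)
        shiftedCell-correct t l len t-ok left s j σ = trans (cell-correct t l len t-ok (suc j) σ)
          (cong (λ y → does (σ ≟ y)) (nth-drop l))
          where
          nth-drop : ∀ l → nth l (suc j) ≡ nth (drop 1 l) j
          nth-drop []      = refl
          nth-drop (x ∷ l) = refl
        shiftedCell-correct t l len t-ok right s zero    σ = refl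
        shiftedCell-correct t l len t-ok right s (suc j) σ = cell-correct t l len t-ok j σ
        shiftedCell-correct t l len t-ok stay  s j       σ = cell-correct t l len t-ok j σ

        frontCell-correct : ∀ mv s σ → [ id , env ] (frontCell mv s σ) ≡ does (σ ≟ front mv lft s rgt)
        frontCell-correct left  s σ = cell-correct onL lft lft-fits (λ _ _ → refl) 0 σ
        frontCell-correct right s σ = cell-correct onR rgt rgt-fits (λ _ _ → refl) 0 σ
        frontCell-correct stay  s σ = refl

        moved-correct : ∀ d u → [ id , env ] (moved d u) ≡ describe (shifted d c) u
        moved-correct (q , s , mv) (st p)    = refl
        moved-correct (q , s , mv) (scan σ)  = frontCell-correct mv s σ
        moved-correct (q , s , mv) (onL i σ) = shiftedCell-correct onL lft lft-fits (λ _ _ → refl) mv s (toℕ i) σ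
        moved-correct (q , s , mv) (onR i σ) =
          shiftedCell-correct onR rgt rgt-fits (λ _ _ → refl) (mirror mv) s (toℕ i) σ

        next-correct : ∀ u β → [ id , env ] (next u state hd β) ≡ describe (advance c β) u
        next-correct u β with halts state
        ... | true  = refl
        ... | false = trans (moved-correct (δ state hd β) u) (cong (λ c′ → describe c′ u) (sym (step-shifted c β)))

        stepFormula-correct : ∀ γ u → ⟦ stepFormula γ u ⟧ env ≡ describe (advance c (ρ γ)) u
        stepFormula-correct γ u =
          trans (⟦lookupTable⟧ stVar scanVar (inj₁ γ) (next u) env state hd (λ _ → refl) (λ _ → refl)) (next-correct u (ρ γ))

      -- `extend` keeps both configurations; the renaming makes the names in `CVar` denote the new
      -- one and forgets those of the old.
      stepProgram : I → Program n (Bool ⊎ (I ⊎ CVar)) → Program n (Bool ⊎ (I ⊎ CVar))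
      stepProgram γ P = relabel (map₁ inj₁) (extend enumeration (stepFormula γ) P)

      execProgram : List I → Program n (Bool ⊎ (I ⊎ CVar)) → Program n (Bool ⊎ (I ⊎ CVar))
      execProgram []       P = P
      execProgram (γ ∷ γs) P = execProgram γs (stepProgram γ P)

      stepProgram-yields : ∀ γ (P : Program n (Bool ⊎ (I ⊎ CVar))) {x ρ} c → Fits W c →
                           Yields P x [ ρ , describe c ] →
                           Yields (stepProgram γ P) x [ ρ , describe (advance c (ρ γ)) ]
      stepProgram-yields γ P {ρ = ρ} c c-fits ok =
        Yields-≗ {P = stepProgram γ P}
          (λ { (inj₁ i) → refl ; (inj₂ u) → stepFormula-correct ρ c c-fits γ u })
          (relabel-yields (map₁ inj₁) {P = extend enumeration (stepFormula γ) P}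
            (extend-yields enumeration (stepFormula γ) P ok))

      -- A half-tape grows by at most one cell per step, so `B` plus the number of remaining steps
      -- never increases and the window is never exceeded.
      execProgram-yields : ∀ γs (P : Program n (Bool ⊎ (I ⊎ CVar))) {x ρ B} c → Fits B c → B + length γs ≤ W →
                           Yields P x [ ρ , describe c ] →
                           Yields (execProgram γs P) x [ ρ , describe (exec M c (map ρ γs)) ]
      execProgram-yields []       P c c-fits room ok = ok
      execProgram-yields (γ ∷ γs) P {x} {ρ} {B} c (fits lenˡ lenʳ) room ok =
        subst (λ c′ → Yields (execProgram (γ ∷ γs) P) x [ ρ , describe c′ ]) (sym (exec-∷ c (ρ γ) (map ρ γs)))
          (execProgram-yields γs (stepProgram γ P) (advance c (ρ γ)) (advance-fits c (ρ γ) (fits lenˡ lenʳ))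
            (≤-trans (≤-reflexive (sym (+-suc B _))) room)
            (stepProgram-yields γ P c (fits (≤-trans lenˡ B≤W) (≤-trans lenʳ B≤W)) ok))
        where
        B≤W : B ≤ W
        B≤W = ≤-trans (m≤m+n B _) room

      stepCost : ℕ
      stepCost = #CVar * tableCost states (3 + extra)

      execProgram-gates : ∀ γs (P : Program n (Bool ⊎ (I ⊎ CVar))) →
                          gatesOf (execProgram γs P) ≤ gatesOf P + length γs * stepCost
      execProgram-gates []       P = m≤m+n _ 0
      execProgram-gates (γ ∷ γs) P =
        ≤-trans (execProgram-gates γs (stepProgram γ P))
          (≤-trans (+-monoˡ-≤ (length γs * stepCost)
                      (extend-gates enumeration (stepFormula γ) P (λ u → lookupTable-cost stVar scanVar (inj₁ γ) (next u))))
                   (≤-reflexive (+-assoc (gatesOf P) stepCost _)))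

-- Initial tape and output

module Tape (M : NTM) where
  open NTM M
  open Machine M

  exec-++ : ∀ c g h → exec M c (g ++ h) ≡ exec M (exec M c g) h
  exec-++ c []      h = refl
  exec-++ c (β ∷ g) h with halted M c in eq
  ... | true  = sym (exec-halted c h eq)
  ... | false = exec-++ (step M c β) g h

  -- A nondeterministic circuit has a witness of fixed length, but an accepting guess string may
  -- have any length. Padding it changes nothing because the machine has halted, and cutting the
  -- result to length `T` changes nothing because every run has halted by then.
  exec-normalise : ∀ c T → (∀ g → length g ≡ T → halted M (exec M c g) ≡ true) →
                   ∀ g → halted M (exec M c g) ≡ true → ∃ λ (f : Fin T → Bool) → exec M c (tabulate f) ≡ exec M c g
  exec-normalise c T halts-by-T g g-halts = resize g₁ len-g₁ , trans (cong (exec M c) (resize-tabulate g₁ len-g₁)) same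
    where
    padded = g ++ replicate T false
    g₁     = take T padded

    resize : ∀ (l : List Bool) {T} → length l ≡ T → Fin T → Bool
    resize l refl = List.lookup l

    resize-tabulate : ∀ (l : List Bool) {T} (len : length l ≡ T) → tabulate (resize l len) ≡ l
    resize-tabulate l refl = tabulate-lookup l

    len-g₁ : length g₁ ≡ T
    len-g₁ = trans (length-take T padded) (m≤n⇒m⊓n≡m
      (subst (T ≤_) (sym (trans (length-++ g) (cong (length g +_) (length-replicate T)))) (m≤n+m T (length g))))

    open ≡-Reasoning
    same : exec M c g₁ ≡ exec M c g
    same = begin
      exec M c g₁                            ≡⟨ exec-halted (exec M c g₁) (drop T padded) (halts-by-T g₁ len-g₁) ⟨
      exec M (exec M c g₁) (drop T padded)   ≡⟨ exec-++ c g₁ (drop T padded) ⟨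
      exec M c (g₁ ++ drop T padded)         ≡⟨ cong (exec M c) (take++drop≡id T padded) ⟩
      exec M c (g ++ replicate T false)      ≡⟨ exec-++ c g (replicate T false) ⟩
      exec M (exec M c g) (replicate T false) ≡⟨ exec-halted (exec M c g) (replicate T false) g-halts ⟩
      exec M c g                             ∎

  accepting-halts : ∀ c → Config.state c ≡ acceptSt → halted M c ≡ true
  accepting-halts c eq = cong (_∨ does (Config.state c ≟ rejectSt)) (dec-true (Config.state c ≟ acceptSt) eq)

  -- `readBits` stops at the first symbol that is not a bit, so an output of length m forces the
  -- first m cells to hold bits.
  readBits-nth : ∀ l (v : Vec Bool m) → readBits M l ≡ toList v → ∀ i → nth l (toℕ i) ≡ bitSym M (Vec.lookup v i)
  readBits-nth [] [] eq ()
  readBits-nth (suc zero ∷ l) (y ∷ v) eq i with ∷-injective eq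
  readBits-nth (suc zero ∷ l) (y ∷ v) eq zero    | refl , eq′ = refl
  readBits-nth (suc zero ∷ l) (y ∷ v) eq (suc i) | refl , eq′ = readBits-nth l v eq′ i
  readBits-nth (suc (suc zero) ∷ l) (y ∷ v) eq i with ∷-injective eq
  readBits-nth (suc (suc zero) ∷ l) (y ∷ v) eq zero    | refl , eq′ = refl
  readBits-nth (suc (suc zero) ∷ l) (y ∷ v) eq (suc i) | refl , eq′ = readBits-nth l v eq′ i
  readBits-nth (zero ∷ l) [] eq ()
  readBits-nth (suc (suc (suc s)) ∷ l) [] eq ()

  does-bitSym : ∀ β → does (bitSym M true ≟ bitSym M β) ≡ β
  does-bitSym false = refl
  does-bitSym true  = refl

  module WindowTape (W : ℕ) {I : Set} where
    open Window W

    -- The input word of the machine is a template: fixed bits of the code are constants, the bits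
    -- of the shifts are wires.
    tapeFormula : List (Bool ⊎ I) → ℕ → Letter → Formula I
    tapeFormula []      j       σ = const (does (σ ≟ blank M))
    tapeFormula (l ∷ τ) zero    σ = case (lit l) λ β → const (does (σ ≟ bitSym M β))
    tapeFormula (l ∷ τ) (suc j) σ = tapeFormula τ j σ

    initFormula : List (Bool ⊎ I) → CVar → Formula I
    initFormula τ (st q)    = const (does (q ≟ start))
    initFormula τ (scan σ)  = tapeFormula τ 0 σ
    initFormula τ (onL i σ) = const (does (σ ≟ blank M))
    initFormula τ (onR i σ) = tapeFormula τ (suc (toℕ i)) σ

    tapeFormula-cost : ∀ τ j σ → cost (tapeFormula τ j σ) ≤ 4
    tapeFormula-cost []      j       σ = z≤n
    tapeFormula-cost (l ∷ τ) zero    σ = ≤-refl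
    tapeFormula-cost (l ∷ τ) (suc j) σ = tapeFormula-cost τ j σ

    initFormula-cost : ∀ τ u → cost (initFormula τ u) ≤ 4
    initFormula-cost τ (st q)    = z≤n
    initFormula-cost τ (scan σ)  = tapeFormula-cost τ 0 σ
    initFormula-cost τ (onL i σ) = z≤n
    initFormula-cost τ (onR i σ) = tapeFormula-cost τ (suc (toℕ i)) σ

    module _ (ρ : I → Bool) where

      initial : List (Bool ⊎ I) → Config M
      initial τ = initConf M (map [ id , ρ ] τ)

      tapeFormula-correct : ∀ τ j σ →
        ⟦ tapeFormula τ j σ ⟧ ρ ≡ does (σ ≟ nth (map (bitSym M) (map [ id , ρ ] τ)) j)
      tapeFormula-correct []      j       σ = refl
      tapeFormula-correct (l ∷ τ) zero    σ = ⟦case⟧ (lit l) (λ β → const (does (σ ≟ bitSym M β))) ρ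
      tapeFormula-correct (l ∷ τ) (suc j) σ = tapeFormula-correct τ j σ

      initFormula-correct : ∀ τ u → ⟦ initFormula τ u ⟧ ρ ≡ describe (initial τ) u
      initFormula-correct []      (st q)    = refl
      initFormula-correct []      (scan σ)  = refl
      initFormula-correct []      (onL i σ) = refl
      initFormula-correct []      (onR i σ) = refl
      initFormula-correct (l ∷ τ) (st q)    = refl
      initFormula-correct (l ∷ τ) (scan σ)  = tapeFormula-correct (l ∷ τ) 0 σ
      initFormula-correct (l ∷ τ) (onL i σ) = refl
      initFormula-correct (l ∷ τ) (onR i σ) = tapeFormula-correct τ (toℕ i) σ

      initial-fits : ∀ τ → Fits (length τ) (initial τ)
      initial-fits []      = fits z≤n z≤n
      initial-fits (l ∷ τ) = fits z≤n
        (≤-trans (≤-reflexive (trans (length-map (bitSym M) (map [ id , ρ ] τ)) (length-map [ id , ρ ] τ))) (n≤1+n _))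

    initProgram : List (Bool ⊎ I) → Program n (Bool ⊎ I) → Program n (Bool ⊎ (I ⊎ CVar))
    initProgram τ = extend enumeration (initFormula τ)

    initProgram-yields : ∀ τ (P : Program n (Bool ⊎ I)) {x ρ} → Yields P x ρ →
                         Yields (initProgram τ P) x [ ρ , describe (initial ρ τ) ]
    initProgram-yields τ P {ρ = ρ} ok =
      Yields-≗ {P = initProgram τ P} (λ { (inj₁ i) → refl ; (inj₂ u) → initFormula-correct ρ τ u })
        (extend-yields enumeration (initFormula τ) P ok)

    -- Testing a cell for the symbol of `true` recovers its bit only if the cell holds a bit at all,
    -- which `readBits-nth` guarantees for an output of the right length.
    outputLit : ℕ → Bool ⊎ (I ⊎ CVar)
    outputLit zero    = inj₂ (inj₂ (scan (bitSym M true)))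
    outputLit (suc j) = cell onR j (bitSym M true)

    outputLit-correct : ∀ ρ c → Fits W c → (v : Vec Bool m) → output M c ≡ toList v →
                        ∀ i → [ id , [ ρ , describe c ] ] (outputLit (toℕ i)) ≡ Vec.lookup v i
    outputLit-correct ρ c c-fits v eq i =
      trans (value (toℕ i))
        (trans (cong (λ s → does (bitSym M true ≟ s)) (readBits-nth (Config.hd c ∷ Config.rgt c) v eq i))
               (does-bitSym (Vec.lookup v i)))
      where
      value : ∀ j → [ id , [ ρ , describe c ] ] (outputLit j)
                  ≡ does (bitSym M true ≟ nth (Config.hd c ∷ Config.rgt c) j)
      value zero    = refl
      value (suc j) = cell-correct ρ c c-fits onR (Config.rgt c) (Fits.rgt-fits c-fits) (λ _ _ → refl) j (bitSym M true)

-- The shifted generator and its encoding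

⟦⊕⟧ : ∀ (φ ψ : Formula V) ρ → ⟦ φ ⊕ᶠ ψ ⟧ ρ ≡ ⟦ φ ⟧ ρ xor ⟦ ψ ⟧ ρ
⟦⊕⟧ φ ψ ρ with ⟦ φ ⟧ ρ
... | false = refl
... | true  = ∨-identityʳ _

⊕-cost : ∀ (φ ψ : Formula V) → cost (φ ⊕ᶠ ψ) ≡ 5 + 2 * (cost φ + cost ψ)
⊕-cost φ ψ = arith (cost φ) (cost ψ)
  where
  arith : ∀ x y → 1 + (1 + (x + (1 + y)) + (1 + (1 + x + y))) ≡ 5 + 2 * (x + y)
  arith = solve-∀

old : ∀ S → Fin r → Fin (S + r)
old zero    i = i
old (suc S) i = inject₁ (old S i)

-- Index zero belongs to the gate added last, in accordance with the recursion of `choices`.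
new : ∀ S → Fin S → Fin (S + r)
new (suc S) zero    = fromℕ _
new (suc S) (suc p) = inject₁ (new S p)

-- The codes of andG and orG differ in a single bit, so every bit of s occupies a fixed position of the
-- encoding, and on inputs starting with false, true the p-th of these gates outputs s p.
choices : ∀ S → (Fin S → Bool) → Gates (2 + r) (S + (2 + r))
choices zero    s = []
choices (suc S) s = choices S (s ∘ suc) ▷ junction (s zero) (old S zero) (old S (suc zero))

choices-old : ∀ S (s : Fin S → Bool) (x : Vec Bool (2 + r)) i →
              lookup (evalGates (choices S s) x) (old S i) ≡ lookup x i
choices-old zero    s x i = refl
choices-old (suc S) s x i =
  trans (lookup-inject₁ (evalGates (choices S (s ∘ suc)) x) _ (old S i)) (choices-old S (s ∘ suc) x i)

choices-new : ∀ S (s : Fin S → Bool) (x : Vec Bool r) p →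
              lookup (evalGates (choices S s) (false ∷ true ∷ x)) (new S p) ≡ s p
choices-new (suc S) s x zero =
  trans (lookup-last u _)
    (trans (evalGate-junction (s zero) _ _ u)
      (trans (cong₂ (connect (s zero)) (choices-old S (s ∘ suc) _ zero) (choices-old S (s ∘ suc) _ (suc zero)))
             (choose (s zero))))
  where
  u = evalGates (choices S (s ∘ suc)) (false ∷ true ∷ x)
  choose : ∀ β → connect β false true ≡ β
  choose false = refl
  choose true  = refl
choices-new (suc S) s x (suc p) =
  trans (lookup-inject₁ (evalGates (choices S (s ∘ suc)) (false ∷ true ∷ x)) _ (new S p)) (choices-new S (s ∘ suc) x p)

choices-cong : ∀ S {s s′ : Fin S → Bool} → s ≗ s′ → choices {r} S s ≡ choices S s′
choices-cong zero    eq = refl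
choices-cong (suc S) eq = cong₂ (λ gs β → gs ▷ junction β (old S zero) (old S (suc zero))) (choices-cong S (eq ∘ suc)) (eq zero)

encGate-junction : ∀ β (i j : Fin w) → encGate (junction β i j) ≡ false ∷ β ∷ encFin i ++ encFin j
encGate-junction false i j = refl
encGate-junction true  i j = refl

-- `encGates` writes the last gate first. The code of gates placed on top of a circuit is thus a
-- prefix, without end marker, of the code of the whole.
gatesPrefix : Gates a b → List Bool
gatesPrefix []       = []
gatesPrefix (gs ▷ g) = true ∷ encGate g ++ gatesPrefix gs

encGates-⋙ : (gs : Gates a b) (hs : Gates b d) → encGates (gs ⋙ hs) ≡ gatesPrefix hs ++ encGates gs
encGates-⋙ gs []       = refl
encGates-⋙ gs (hs ▷ g) =
  cong (true ∷_) (trans (cong (encGate g ++_) (encGates-⋙ gs hs)) (sym (++-assoc (encGate g) _ _)))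

map-inj₁ : (ρ : I → Bool) (bs : List Bool) → map [ id , ρ ] (map inj₁ bs) ≡ bs
map-inj₁ ρ bs = trans (sym (map-∘ bs)) (map-id bs)

-- The template for the code of `choices`. The wire indices in it depend on the number of gates but
-- not on the shifts, so they are constant; the second bit of each gate code is the variable.
choiceCode : ∀ r S → (Fin S → I) → List (Bool ⊎ I)
choiceCode r zero    p = inj₁ false ∷ []
choiceCode r (suc S) p = inj₁ true ∷ inj₁ false ∷ inj₂ (p zero) ∷
  map inj₁ (encFin (old {2 + r} S zero) ++ encFin (old {2 + r} S (suc zero))) ++ choiceCode r S (p ∘ suc)

choiceCode-correct : ∀ S (p : Fin S → I) ρ → encGates (choices {r} S (ρ ∘ p)) ≡ map [ id , ρ ] (choiceCode r S p)
choiceCode-correct zero    p ρ = refl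
choiceCode-correct {r = r} (suc S) p ρ =
  cong (true ∷_)
    (trans (cong₂ _++_ (encGate-junction (ρ (p zero)) (old S zero) (old S (suc zero))) (choiceCode-correct S (p ∘ suc) ρ))
      (cong (λ l → false ∷ ρ (p zero) ∷ l)
        (sym (trans (map-++ [ id , ρ ] (map inj₁ bits) (choiceCode r S (p ∘ suc)))
                    (cong (_++ map [ id , ρ ] (choiceCode r S (p ∘ suc))) (map-inj₁ ρ bits))))))
  where
  bits = encFin (old {2 + r} S zero) ++ encFin (old {2 + r} S (suc zero))

-- The bitwise disjunction of the shifts selected by `w`; a one-hot `w` gives a single shift.
mask : (Fin (k * m) → Bool) → (Fin k → Bool) → Fin m → Bool
mask s w i = reduce true (λ j → w j ∧ s (combine j i))

maskFormula : (Fin (k * m) → V) → (Fin k → V) → Fin m → Formula V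
maskFormula s w i = big true (λ j → var (w j) ∧ᶠ var (s (combine j i)))

⟦mask⟧ : ∀ (s : Fin (k * m) → V) (w : Fin k → V) i ρ → ⟦ maskFormula s w i ⟧ ρ ≡ mask (ρ ∘ s) (ρ ∘ w) i
⟦mask⟧ s w i ρ = ⟦big⟧ true (λ j → var (w j) ∧ᶠ var (s (combine j i))) ρ

maskFormula-cost : ∀ (s : Fin (k * m) → V) (w : Fin k → V) i → cost (maskFormula s w i) ≤ k * 2
maskFormula-cost s w i = big-cost true (λ j → var (w j) ∧ᶠ var (s (combine j i))) (λ j → ≤-refl)

mask-cong : ∀ {s s′ : Fin (k * m) → Bool} {w w′ : Fin k → Bool} → s ≗ s′ → w ≗ w′ → mask {k} {m} s w ≗ mask s′ w′
mask-cong s≗ w≗ i = reduce-cong true λ j → cong₂ _∧_ (w≗ j) (s≗ (combine j i))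

module Shifted {n m : ℕ} (G : Circuit n m) (k : ℕ) where

  S : ℕ
  S = k * m

  -- The wires below the fixed part: the gates that produce the bits of the shifts, the two inputs
  -- meant for false and true, the seed and the selectors.
  base : ℕ
  base = S + (2 + (n + k))

  seedWire : Fin n → Fin base
  seedWire i = old S (suc (suc (i ↑ˡ k)))

  selectorWire : Fin k → Fin base
  selectorWire j = old S (suc (suc (n ↑ʳ j)))

  simulated : Program base (Bool ⊎ (Fin base ⊎ Fin (wires G)))
  simulated = simulate seedWire (gates G) (inputs (old S zero))

  outFormula : Fin m → Formula (Fin base ⊎ Fin (wires G))
  outFormula i = var (inj₂ (lookup (outs G) i)) ⊕ᶠ maskFormula (inj₁ ∘ new S) (inj₁ ∘ selectorWire) i

  -- Independent of the shifts, which it reads from wires. Hence everything in the code before and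
  -- after the choice gates is fixed.
  common : Program base (Bool ⊎ ((Fin base ⊎ Fin (wires G)) ⊎ Fin m))
  common = extend (↔-id (Fin m)) outFormula simulated

  shiftedCircuit : (Fin S → Bool) → Circuit (2 + (n + k)) m
  shiftedCircuit s = circuit (width common) (choices S s ⋙ code common) (Vec.tabulate (λ i → wire common (inj₂ (inj₂ i))))

  -- Shifts read back from a witness agree with the intended ones only pointwise.
  shiftedCircuit-cong : ∀ {s s′} → s ≗ s′ → shiftedCircuit s ≡ shiftedCircuit s′
  shiftedCircuit-cong eq = cong (λ gs → circuit (width common) (gs ⋙ code common) (Vec.tabulate (λ i → wire common (inj₂ (inj₂ i)))))
    (choices-cong S eq)

  shiftedCircuit-eval : ∀ s (x : Vec Bool n) (w : Vec Bool k) i →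
    lookup (eval (shiftedCircuit s) (false ∷ true ∷ (x Vec.++ w))) i ≡ lookup (eval G x) i xor mask s (lookup w) i
  shiftedCircuit-eval s x w i =
    begin
      lookup (Vec.map (lookup (evalGates (choices S s ⋙ code common) z)) (Vec.tabulate outWire)) i
        ≡⟨ lookup-map i (lookup (evalGates (choices S s ⋙ code common) z)) (Vec.tabulate outWire) ⟩
      lookup (evalGates (choices S s ⋙ code common) z) (lookup (Vec.tabulate outWire) i)
        ≡⟨ cong₂ lookup (evalGates-⋙ (choices S s) (code common) z) (lookup∘tabulate outWire i) ⟩
      run common u (inj₂ (inj₂ i))
        ≡⟨ extend-yields (↔-id (Fin m)) outFormula simulated simulated-yields (inj₂ (inj₂ i)) ⟩
      ⟦ outFormula i ⟧ env
        ≡⟨ ⟦⊕⟧ (var (inj₂ (lookup (outs G) i))) (maskFormula (inj₁ ∘ new S) (inj₁ ∘ selectorWire) i) env ⟩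
      lookup (evalGates (gates G) x) (lookup (outs G) i) xor ⟦ maskFormula (inj₁ ∘ new S) (inj₁ ∘ selectorWire) i ⟧ env
        ≡⟨ cong₂ _xor_ (sym (lookup-map i (lookup (evalGates (gates G) x)) (outs G)))
             (trans (⟦mask⟧ (inj₁ ∘ new S) (inj₁ ∘ selectorWire) i env)
                    (mask-cong {k} {m} (choices-new S s (x Vec.++ w)) selector i)) ⟩
      lookup (eval G x) i xor mask s (lookup w) i ∎
    where
    open ≡-Reasoning
    outWire : Fin m → Fin (width common)
    outWire i = wire common (inj₂ (inj₂ i))
    z = false ∷ true ∷ (x Vec.++ w)
    u = evalGates (choices S s) z
    env : Fin base ⊎ Fin (wires G) → Bool
    env = [ lookup u , lookup (evalGates (gates G) x) ]
    selector : ∀ j → lookup u (selectorWire j) ≡ lookup w j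
    selector j = trans (choices-old S s z _) (lookup-++ʳ x w j)
    simulated-yields : Yields simulated u env
    simulated-yields = simulate-yields seedWire (gates G) (inputs (old S zero)) x
      (λ i → trans (choices-old S s z _) (lookup-++ˡ x w i)) (inputs-yields (old S zero) u)

  header : List Bool
  header = encℕ (2 + (n + k)) ++ encℕ m ++ encℕ (width common) ++ gatesPrefix (code common)

  footer : List Bool
  footer = encOuts (Vec.tabulate (λ i → wire common (inj₂ (inj₂ i))))

  shiftedCode : (Fin S → I) → List (Bool ⊎ I)
  shiftedCode p = map inj₁ header ++ choiceCode (n + k) S p ++ map inj₁ footer

  shiftedCode-correct : ∀ (p : Fin S → I) ρ → encCircuit (shiftedCircuit (ρ ∘ p)) ≡ map [ id , ρ ] (shiftedCode p)
  shiftedCode-correct p ρ = begin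
    A ++ B ++ C ++ encGates (choices S (ρ ∘ p) ⋙ code common) ++ footer
      ≡⟨ cong (λ l → A ++ B ++ C ++ l ++ footer) (encGates-⋙ (choices S (ρ ∘ p)) (code common)) ⟩
    A ++ B ++ C ++ (D ++ encGates (choices S (ρ ∘ p))) ++ footer
      ≡⟨ cong (λ l → A ++ B ++ C ++ l) (++-assoc D _ footer) ⟩
    A ++ B ++ C ++ D ++ encGates (choices S (ρ ∘ p)) ++ footer
      ≡⟨ cong (λ l → A ++ B ++ l) (++-assoc C D _) ⟨
    A ++ B ++ (C ++ D) ++ encGates (choices S (ρ ∘ p)) ++ footer
      ≡⟨ cong (A ++_) (++-assoc B (C ++ D) _) ⟨
    A ++ (B ++ C ++ D) ++ encGates (choices S (ρ ∘ p)) ++ footer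
      ≡⟨ ++-assoc A (B ++ C ++ D) _ ⟨
    header ++ encGates (choices S (ρ ∘ p)) ++ footer
      ≡⟨ cong₂ _++_ (map-inj₁ ρ header) (cong₂ _++_ (sym (choiceCode-correct S p ρ)) (map-inj₁ ρ footer)) ⟨
    map ρ̂ (map inj₁ header) ++ map ρ̂ (choiceCode (n + k) S p) ++ map ρ̂ (map inj₁ footer)
      ≡⟨ cong (map ρ̂ (map inj₁ header) ++_) (map-++ ρ̂ (choiceCode (n + k) S p) _) ⟨
    map ρ̂ (map inj₁ header) ++ map ρ̂ (choiceCode (n + k) S p ++ map inj₁ footer)
      ≡⟨ map-++ ρ̂ (map inj₁ header) _ ⟨
    map ρ̂ (shiftedCode p) ∎
    where
    open ≡-Reasoning
    ρ̂ = [ id , ρ ]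
    A = encℕ (2 + (n + k))
    B = encℕ m
    C = encℕ (width common)
    D = gatesPrefix (code common)

  common-gates : gatesOf common ≤ 3 + gateCount (gates G) + m * (5 + 2 * (k * 2))
  common-gates =
    ≤-trans (extend-gates (↔-id (Fin m)) outFormula simulated bound)
      (+-monoˡ-≤ _ (simulate-gates seedWire (gates G) (inputs (old S zero))))
    where
    bound : ∀ i → cost (outFormula i) ≤ 5 + 2 * (k * 2)
    bound i = ≤-trans (≤-reflexive (⊕-cost (var (inj₂ (lookup (outs G) i))) (maskFormula (inj₁ ∘ new S) (inj₁ ∘ selectorWire) i)))
      (+-monoʳ-≤ 5 (*-monoʳ-≤ 2 (maskFormula-cost (inj₁ ∘ new S) (inj₁ ∘ selectorWire) i)))

-- Choosing shifts greedily

bit : Bool → ℕ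
bit b = if b then 1 else 0

countL-concatMap : ∀ (p : Y → Bool) (f g : X → Y) l →
  countL p (concatMap (λ v → f v ∷ g v ∷ []) l) ≡ countL (p ∘ f) l + countL (p ∘ g) l
countL-concatMap p f g []      = refl
countL-concatMap p f g (a ∷ l) =
  trans (cong (λ t → bit (p (f a)) + (bit (p (g a)) + t)) (countL-concatMap p f g l))
        (arith (bit (p (f a))) (bit (p (g a))) (countL (p ∘ f) l) (countL (p ∘ g) l))
  where
  arith : ∀ x y u v → x + (y + (u + v)) ≡ x + u + (y + v)
  arith = solve-∀

anyL-concatMap : ∀ (p : Y → Bool) (f g : X → Y) l →
  anyL p (concatMap (λ v → f v ∷ g v ∷ []) l) ≡ anyL (λ a → p (f a) ∨ p (g a)) l
anyL-concatMap p f g []      = refl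
anyL-concatMap p f g (a ∷ l) =
  trans (cong (λ t → p (f a) ∨ (p (g a) ∨ t)) (anyL-concatMap p f g l)) (sym (∨-assoc (p (f a)) (p (g a)) _))

anyL-allVecs : ∀ (p : Vec Bool N → Bool) v → p v ≡ true → anyL p (allVecs N) ≡ true
anyL-allVecs p []      pv = cong (_∨ false) pv
anyL-allVecs {suc N} p (β ∷ v) pv = trans (anyL-concatMap p (false ∷_) (true ∷_) (allVecs N)) (anyL-allVecs _ v (either β pv))
  where
  either : ∀ β → p (β ∷ v) ≡ true → p (false ∷ v) ∨ p (true ∷ v) ≡ true
  either false eq = cong (_∨ p (true ∷ v)) eq
  either true  eq = trans (cong (p (false ∷ v) ∨_) eq) (∨-zeroʳ _)

anyL-none : ∀ (p : X → Bool) → (∀ a → p a ≡ false) → ∀ l → anyL p l ≡ false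
anyL-none p none []      = refl
anyL-none p none (a ∷ l) = cong₂ _∨_ (none a) (anyL-none p none l)

-- `allVecs` interleaves the two values of the first bit; splitting the sum on that bit instead
-- makes exchange of sums and invariance under `⊕` direct inductions.
total : ∀ N → (Vec Bool N → ℕ) → ℕ
total zero    f = f []
total (suc N) f = total N (f ∘ (false ∷_)) + total N (f ∘ (true ∷_))

countL-total : ∀ N (p : Vec Bool N → Bool) → countL p (allVecs N) ≡ total N (bit ∘ p)
countL-total zero    p = +-identityʳ _
countL-total (suc N) p = trans (countL-concatMap p (false ∷_) (true ∷_) (allVecs N))
                               (cong₂ _+_ (countL-total N (p ∘ (false ∷_))) (countL-total N (p ∘ (true ∷_))))

total-cong : ∀ N {f g : Vec Bool N → ℕ} → f ≗ g → total N f ≡ total N g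
total-cong zero    eq = eq []
total-cong (suc N) eq = cong₂ _+_ (total-cong N (eq ∘ (false ∷_))) (total-cong N (eq ∘ (true ∷_)))

total-+ : ∀ N (f g : Vec Bool N → ℕ) → total N (λ v → f v + g v) ≡ total N f + total N g
total-+ zero    f g = refl
total-+ (suc N) f g =
  trans (cong₂ _+_ (total-+ N (f ∘ (false ∷_)) (g ∘ (false ∷_))) (total-+ N (f ∘ (true ∷_)) (g ∘ (true ∷_))))
        (arith (total N (f ∘ (false ∷_))) _ (total N (f ∘ (true ∷_))) _)
  where
  arith : ∀ x y u v → x + y + (u + v) ≡ x + u + (y + v)
  arith = solve-∀

total-* : ∀ N c (f : Vec Bool N → ℕ) → total N (λ v → f v * c) ≡ total N f * c
total-* zero    c f = refl
total-* (suc N) c f = trans (cong₂ _+_ (total-* N c (f ∘ (false ∷_))) (total-* N c (f ∘ (true ∷_))))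
                            (sym (*-distribʳ-+ c (total N (f ∘ (false ∷_))) _))

total-swap : ∀ N K (f : Vec Bool N → Vec Bool K → ℕ) →
             total N (λ u → total K (f u)) ≡ total K (λ v → total N (λ u → f u v))
total-swap zero    K f = refl
total-swap (suc N) K f = trans (cong₂ _+_ (total-swap N K (f ∘ (false ∷_))) (total-swap N K (f ∘ (true ∷_))))
                               (sym (total-+ K _ _))

total-one : ∀ N → total N (λ _ → 1) ≡ 2 ^ N
total-one zero    = refl
total-one (suc N) = cong₂ _+_ (total-one N) (trans (total-one N) (sym (+-identityʳ _)))

term-≤-total : ∀ (f : Vec Bool N → ℕ) v → f v ≤ total N f
term-≤-total f []          = ≤-refl
term-≤-total f (false ∷ v) = ≤-trans (term-≤-total (f ∘ (false ∷_)) v) (m≤m+n _ _)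
term-≤-total f (true ∷ v)  = ≤-trans (term-≤-total (f ∘ (true ∷_)) v) (m≤n+m _ _)

infixl 6 _⊕_

_⊕_ : Vec Bool N → Vec Bool N → Vec Bool N
_⊕_ = zipWith _xor_

total-⊕ : ∀ (z : Vec Bool N) (f : Vec Bool N → ℕ) → total N (λ s → f (z ⊕ s)) ≡ total N f
total-⊕ []          f = refl
total-⊕ (false ∷ z) f = cong₂ _+_ (total-⊕ z (f ∘ (false ∷_))) (total-⊕ z (f ∘ (true ∷_)))
total-⊕ (true ∷ z)  f = trans (cong₂ _+_ (total-⊕ z (f ∘ (true ∷_))) (total-⊕ z (f ∘ (false ∷_)))) (+-comm (total _ (f ∘ (true ∷_))) _)

double : ∀ x y → 2 * x * y ≡ x * y + x * y
double = solve-∀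

≤-average : ∀ N (f : Vec Bool N → ℕ) → ∃ λ v → 2 ^ N * f v ≤ total N f
≤-average zero    f = [] , ≤-reflexive (+-identityʳ _)
≤-average (suc N) f with ≤-total (total N (f ∘ (false ∷_))) (total N (f ∘ (true ∷_)))
                       | ≤-average N (f ∘ (false ∷_)) | ≤-average N (f ∘ (true ∷_))
... | inj₁ l≤r | v , le | _ =
  false ∷ v , ≤-trans (≤-reflexive (double (2 ^ N) (f (false ∷ v)))) (+-mono-≤ le (≤-trans le l≤r))
... | inj₂ r≤l | _ | v , le =
  true ∷ v , ≤-trans (≤-reflexive (double (2 ^ N) (f (true ∷ v)))) (+-mono-≤ (≤-trans le r≤l) le)

bit-∧ : ∀ a b → bit (a ∧ b) ≡ bit b * bit a
bit-∧ false false = refl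
bit-∧ false true  = refl
bit-∧ true  false = refl
bit-∧ true  true  = refl

module Hitting {N : ℕ} (A : Vec Bool N → Bool) (sparse : 3 * total N (bit ∘ A) ≤ 2 ^ N) where

  size-of : (Vec Bool N → Bool) → ℕ
  size-of B = total N (bit ∘ B)

  -- For fixed z, the string z ⊕ s runs through all strings as s does, so each z in `B` is counted
  -- once for every element of `A`.
  double-count : ∀ B → total N (λ s → size-of (λ z → B z ∧ A (z ⊕ s))) ≡ size-of A * size-of B
  double-count B = begin
    total N (λ s → total N (λ z → bit (B z ∧ A (z ⊕ s))))
      ≡⟨ total-swap N N (λ s z → bit (B z ∧ A (z ⊕ s))) ⟩
    total N (λ z → total N (λ s → bit (B z ∧ A (z ⊕ s))))
      ≡⟨ total-cong N (λ z → trans (total-cong N (λ s → bit-∧ (B z) (A (z ⊕ s)))) (total-* N (bit (B z)) _)) ⟩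
    total N (λ z → total N (λ s → bit (A (z ⊕ s))) * bit (B z))
      ≡⟨ total-cong N (λ z → trans (cong (_* bit (B z)) (total-⊕ z (bit ∘ A))) (*-comm (size-of A) (bit (B z)))) ⟩
    total N (λ z → bit (B z) * size-of A)
      ≡⟨ total-* N (size-of A) (bit ∘ B) ⟩
    size-of B * size-of A
      ≡⟨ *-comm (size-of B) (size-of A) ⟩
    size-of A * size-of B ∎
    where open ≡-Reasoning

  shrink : ∀ B → ∃ λ s → 3 * size-of (λ z → B z ∧ A (z ⊕ s)) ≤ size-of B
  shrink B with ≤-average N (λ s → size-of (λ z → B z ∧ A (z ⊕ s)))
  ... | s , le = s , *-cancelˡ-≤ (2 ^ N) {{m^n≢0 2 N}} (begin
    2 ^ N * (3 * hits)          ≡⟨ arith (2 ^ N) hits ⟩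
    3 * (2 ^ N * hits)          ≤⟨ *-monoʳ-≤ 3 (≤-trans le (≤-reflexive (double-count B))) ⟩
    3 * (size-of A * size-of B) ≡⟨ *-assoc 3 (size-of A) (size-of B) ⟨
    3 * size-of A * size-of B   ≤⟨ *-monoˡ-≤ (size-of B) sparse ⟩
    2 ^ N * size-of B           ∎)
    where
    open ≤-Reasoning
    hits = size-of (λ z → B z ∧ A (z ⊕ s))
    arith : ∀ x y → x * (3 * y) ≡ 3 * (x * y)
    arith = solve-∀

  -- Stated for an arbitrary `B`, since each chosen shift replaces the set by the part of it that
  -- survives.
  shrink* : ∀ k B → ∃ λ (s : Fin k → Vec Bool N) →
            3 ^ k * size-of (λ z → B z ∧ reduce false (λ i → A (z ⊕ s i))) ≤ size-of B
  shrink* zero    B = (λ ()) , ≤-reflexive (trans (+-identityʳ _) (total-cong N (λ z → cong bit (∧-identityʳ (B z)))))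
  shrink* (suc k) B with shrink B
  ... | s₀ , le₀ with shrink* k (λ z → B z ∧ A (z ⊕ s₀))
  ... | s , le = s⁺ , (begin
    3 * 3 ^ k * size-of (λ z → B z ∧ (A (z ⊕ s₀) ∧ rest z))   ≡⟨ *-assoc 3 (3 ^ k) _ ⟩
    3 * (3 ^ k * size-of (λ z → B z ∧ (A (z ⊕ s₀) ∧ rest z)))
      ≡⟨ cong (λ t → 3 * (3 ^ k * t)) (total-cong N (λ z → cong bit (sym (∧-assoc (B z) _ _)))) ⟩
    3 * (3 ^ k * size-of (λ z → (B z ∧ A (z ⊕ s₀)) ∧ rest z)) ≤⟨ *-monoʳ-≤ 3 le ⟩
    3 * size-of (λ z → B z ∧ A (z ⊕ s₀))                      ≤⟨ le₀ ⟩
    size-of B ∎)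
    where
    open ≤-Reasoning
    rest : Vec Bool N → Bool
    rest z = reduce false (λ i → A (z ⊕ s i))
    s⁺ : Fin (suc k) → Vec Bool N
    s⁺ zero    = s₀
    s⁺ (suc i) = s i

  -- A surviving z would make the count of survivors at least 1, and the bound of `shrink*` would
  -- give 3 ^ k ≤ 2 ^ N.
  shifts-escape : ∀ k → 2 ^ N < 3 ^ k → ∃ λ (s : Fin k → Vec Bool N) → ∀ z → ¬ (∀ i → A (z ⊕ s i) ≡ true)
  shifts-escape k big with shrink* k (λ _ → true)
  ... | s , le = s , λ z all → <-irrefl refl (begin-strict
    3 ^ k                                                ≡⟨ *-identityʳ (3 ^ k) ⟨
    3 ^ k * 1                                            ≡⟨ cong (λ b → 3 ^ k * bit b) (reduce-∧⁺ all) ⟨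
    3 ^ k * bit (reduce false (λ i → A (z ⊕ s i)))
      ≤⟨ *-monoʳ-≤ (3 ^ k) (term-≤-total (λ z → bit (reduce false (λ i → A (z ⊕ s i)))) z) ⟩
    3 ^ k * size-of (λ z → reduce false (λ i → A (z ⊕ s i))) ≤⟨ le ⟩
    size-of (λ _ → true)                                 ≡⟨ total-one N ⟩
    2 ^ N                                                <⟨ big ⟩
    3 ^ k                                                ∎)
    where open ≤-Reasoning

-- Polynomial bounds

-- Equivalent to PolyBounded; bounds of this shape multiply by adding exponents.
Poly : (ℕ → ℕ) → Set
Poly f = ∃ λ c → ∀ n → f n ≤ (2 + n) ^ c

poly-≤ : ∀ {f g} → (∀ n → f n ≤ g n) → Poly g → Poly f
poly-≤ f≤g (c , le) = c , λ n → ≤-trans (f≤g n) (le n)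

poly-id : Poly id
poly-id = 1 , λ n → ≤-trans (m≤n+m n 2) (≤-reflexive (sym (*-identityʳ (2 + n))))

n≤2^n : ∀ n → n ≤ 2 ^ n
n≤2^n zero    = z≤n
n≤2^n (suc n) = +-mono-≤ (m^n>0 2 n) (≤-trans (n≤2^n n) (m≤m+n _ 0))

poly-const : ∀ d → Poly (λ _ → d)
poly-const d = d , λ n → ≤-trans (n≤2^n d) (^-monoˡ-≤ d (m≤m+n 2 n))

poly-* : ∀ {f g} → Poly f → Poly g → Poly (λ n → f n * g n)
poly-* (c , le) (d , le′) = c + d , λ n →
  ≤-trans (*-mono-≤ (le n) (le′ n)) (≤-reflexive (sym (^-distribˡ-+-* (2 + n) c d)))

poly-+ : ∀ {f g} → Poly f → Poly g → Poly (λ n → f n + g n)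
-- The additional factor 2 + n is at least 2 and absorbs the sum of two terms.
poly-+ (c , le) (d , le′) = suc (c + d) , λ n →
  ≤-trans (+-mono-≤ (≤-trans (le n) (^-monoʳ-≤ (2 + n) (m≤m+n c d))) (≤-trans (le′ n) (^-monoʳ-≤ (2 + n) (m≤n+m d c))))
    (+-monoʳ-≤ ((2 + n) ^ (c + d)) (m≤m+n _ (n * (2 + n) ^ (c + d))))

poly-^ : ∀ {f} d → Poly f → Poly (λ n → f n ^ d)
poly-^ d (c , le) = c * d , λ n → ≤-trans (^-monoˡ-≤ d (le n)) (≤-reflexive (^-*-assoc (2 + n) c d))

poly-pow : ∀ {f} d → Poly f → Poly (λ n → d * f n ^ d + d)
poly-pow d p = poly-+ (poly-* (poly-const d) (poly-^ d p)) (poly-const d)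

polyBounded⇒poly : ∀ {f} → PolyBounded f → Poly f
polyBounded⇒poly (c , le) = poly-≤ le (poly-pow c poly-id)

^-distribʳ-* : ∀ d m n → (m * n) ^ d ≡ m ^ d * n ^ d
^-distribʳ-* zero    m n = refl
^-distribʳ-* (suc d) m n = trans (cong (m * n *_) (^-distribʳ-* d m n)) (arith m n (m ^ d) (n ^ d))
  where
  arith : ∀ x y u v → x * y * (u * v) ≡ x * u * (y * v)
  arith = solve-∀

poly⇒polyBounded : ∀ {f} → Poly f → PolyBounded f
poly⇒polyBounded {f} (c , le) = e , λ n → ≤-trans (le n) (bound n)
  where
  -- A single number must serve as coefficient, exponent and additive constant: 3 ^ c comes from 2 +
  -- n ≤ 3 * n for positive n, and c is the exponent needed.
  e = 3 ^ c + c
  bound : ∀ n → (2 + n) ^ c ≤ e * n ^ e + e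
  bound zero    = ≤-trans (^-monoˡ-≤ c (s≤s (s≤s z≤n))) (≤-trans (m≤m+n _ c) (m≤n+m e (e * 0 ^ e)))
  bound n@(suc k) = begin
    (2 + n) ^ c       ≤⟨ ^-monoˡ-≤ c 2+n≤3n ⟩
    (3 * n) ^ c       ≡⟨ ^-distribʳ-* c 3 n ⟩
    3 ^ c * n ^ c     ≤⟨ *-mono-≤ (m≤m+n (3 ^ c) c) (^-monoʳ-≤ n (m≤n+m c (3 ^ c))) ⟩
    e * n ^ e         ≤⟨ m≤m+n _ e ⟩
    e * n ^ e + e     ∎
    where
    open ≤-Reasoning
    2+n≤3n : 3 + k ≤ 3 * suc k
    2+n≤3n = ≤-trans (+-monoʳ-≤ 3 (m≤m+n k (k + k))) (≤-reflexive (arith k))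
      where
      arith : ∀ k → 3 + (k + (k + k)) ≡ 3 * (1 + k)
      arith = solve-∀

-- Length of the encodings

numeralBound : ℕ → ℕ
numeralBound n = 2 * n + 2

-- Deliberately crude: the length is logarithmic in the number, but a linear bound already keeps the
-- code polynomial.
length-encℕᵇ : ∀ b → length (encℕᵇ b) ≤ numeralBound (ℕᵇ.toℕ b)
length-encℕᵇ ℕᵇ.zero    = ≤-refl
length-encℕᵇ 2[1+ b ] = ≤-trans (+-monoʳ-≤ 2 (length-encℕᵇ b)) (≤-trans (m≤m+n _ (2 * ℕᵇ.toℕ b + 2)) (≤-reflexive (arith (ℕᵇ.toℕ b))))
  where
  arith : ∀ x → 2 + (2 * x + 2) + (2 * x + 2) ≡ 2 * (2 * (1 + x)) + 2
  arith = solve-∀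
length-encℕᵇ 1+[2 b ] = ≤-trans (+-monoʳ-≤ 2 (length-encℕᵇ b)) (≤-trans (m≤m+n _ (2 * ℕᵇ.toℕ b)) (≤-reflexive (arith (ℕᵇ.toℕ b))))
  where
  arith : ∀ x → 2 + (2 * x + 2) + 2 * x ≡ 2 * (1 + 2 * x) + 2
  arith = solve-∀

length-encℕ : ∀ n → length (encℕ n) ≤ numeralBound n
length-encℕ n = ≤-trans (length-encℕᵇ (ℕᵇ.fromℕ n)) (≤-reflexive (cong numeralBound (toℕ-fromℕ n)))

numeralBound-mono : ∀ {m n} → m ≤ n → numeralBound m ≤ numeralBound n
numeralBound-mono m≤n = +-monoˡ-≤ 2 (*-monoʳ-≤ 2 m≤n)

length-encFin : ∀ {B} → w ≤ B → (i : Fin w) → length (encFin i) ≤ numeralBound B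
length-encFin w≤B i = ≤-trans (length-encℕ (toℕ i)) (numeralBound-mono (≤-trans (toℕ≤n i) w≤B))

length-encFin² : ∀ {B} → w ≤ B → (i j : Fin w) → length (encFin i ++ encFin j) ≤ 2 * numeralBound B
length-encFin² {B = B} w≤B i j = ≤-trans (≤-reflexive (length-++ (encFin i)))
  (+-mono-≤ (length-encFin w≤B i) (≤-trans (length-encFin w≤B j) (m≤m+n _ 0)))

-- The 3 counts the continuation bit of `encGates` and the two bits for the kind of gate; at most
-- two wire indices follow.
gateBound : ℕ → ℕ
gateBound B = 3 + 2 * numeralBound B

length-encGate : ∀ {B} → w ≤ B → (g : Gate w) → suc (length (encGate g)) ≤ gateBound B
length-encGate w≤B (andG i j) = +-monoʳ-≤ 3 (length-encFin² w≤B i j)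
length-encGate w≤B (orG i j)  = +-monoʳ-≤ 3 (length-encFin² w≤B i j)
length-encGate w≤B (notG i)   = +-monoʳ-≤ 3 (≤-trans (length-encFin w≤B i) (m≤m+n _ _))

length-gatesPrefix : ∀ {B} → b ≤ B → (gs : Gates a b) → length (gatesPrefix gs) ≤ gateCount gs * gateBound B
length-gatesPrefix b≤B []       = z≤n
length-gatesPrefix b≤B (gs ▷ g) =
  ≤-trans (≤-reflexive (cong suc (length-++ (encGate g))))
    (+-mono-≤ (length-encGate (<⇒≤ b≤B) g) (length-gatesPrefix (<⇒≤ b≤B) gs))

length-encOuts : ∀ {B} → w ≤ B → (is : Vec (Fin w) m) → length (encOuts is) ≤ m * numeralBound B
length-encOuts w≤B []       = z≤n
length-encOuts w≤B (i ∷ is) = ≤-trans (≤-reflexive (length-++ (encFin i))) (+-mono-≤ (length-encFin w≤B i) (length-encOuts w≤B is))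

length-choiceCode : ∀ {B} S (p : Fin S → I) → S + (2 + r) ≤ B → length (choiceCode r S p) ≤ 1 + S * gateBound B
length-choiceCode zero p le = ≤-refl
length-choiceCode {r = r} {B = B} (suc S) p le = begin
  3 + length (map inj₁ bits ++ choiceCode r S (p ∘ suc))
    ≡⟨ cong (3 +_) (trans (length-++ (map inj₁ bits)) (cong (_+ length (choiceCode r S (p ∘ suc))) (length-map inj₁ bits))) ⟩
  3 + (length bits + length (choiceCode r S (p ∘ suc)))
    ≤⟨ +-monoʳ-≤ 3 (+-mono-≤ (length-encFin² (<⇒≤ le) (old S zero) (old S (suc zero))) (length-choiceCode S (p ∘ suc) (<⇒≤ le))) ⟩
  3 + (2 * numeralBound B + (1 + S * gateBound B))
    ≡⟨ arith (2 * numeralBound B) (S * gateBound B) ⟩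
  1 + (gateBound B + S * gateBound B) ∎
  where
  open ≤-Reasoning
  bits = encFin (old {2 + r} S zero) ++ encFin (old {2 + r} S (suc zero))
  arith : ∀ x y → 3 + (x + (1 + y)) ≡ 1 + (3 + x + y)
  arith = solve-∀

length-choiceCode-≡ : ∀ {J : Set} S (p : Fin S → I) (q : Fin S → J) →
                      length (choiceCode r S p) ≡ length (choiceCode r S q)
length-choiceCode-≡ zero p q = refl
length-choiceCode-≡ {r = r} (suc S) p q = cong (3 +_)
  (trans (length-++ (map inj₁ bits))
    (trans (cong₂ _+_ (trans (length-map inj₁ bits) (sym (length-map inj₁ bits))) (length-choiceCode-≡ S (p ∘ suc) (q ∘ suc)))
      (sym (length-++ (map inj₁ bits)))))
  where
  bits = encFin (old {2 + r} S zero) ++ encFin (old {2 + r} S (suc zero))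

-- In these bounds n, m, k and g stand for the input and output lengths and the gate count of the generator and the number of shifts.
commonBound : ℕ → ℕ → ℕ → ℕ
commonBound m k g = 3 + g + m * (5 + 2 * (k * 2))

wireBound : ℕ → ℕ → ℕ → ℕ → ℕ
wireBound n m k g = k * m + (2 + (n + k)) + commonBound m k g

codeBound : ℕ → ℕ → ℕ → ℕ → ℕ
codeBound n m k g =
  numeralBound (2 + (n + k)) + (numeralBound m + (numeralBound B + commonBound m k g * gateBound B))
    + (1 + k * m * gateBound B + m * numeralBound B)
  where B = wireBound n m k g

module _ {n m : ℕ} (G : Circuit n m) (k : ℕ) where
  open Shifted G k

  widthBound : ℕ
  widthBound = wireBound n m k (gateCount (gates G))

  width-bound : width common ≤ widthBound
  width-bound = ≤-trans (≤-reflexive (wires-count (code common))) (+-monoʳ-≤ base common-gates)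

  length-shiftedCode : (p : Fin S → I) → length (shiftedCode p) ≤ codeBound n m k (gateCount (gates G))
  length-shiftedCode p =
    ≤-trans (≤-reflexive (trans (length-++ (map inj₁ header))
        (cong₂ _+_ (length-map inj₁ header)
          (trans (length-++ (choiceCode (n + k) S p)) (cong (length (choiceCode (n + k) S p) +_) (length-map inj₁ footer))))))
      (+-mono-≤ header-bound
        (+-mono-≤ (length-choiceCode S p (m≤m+n base _)) (length-encOuts width-bound (Vec.tabulate (λ i → wire common (inj₂ (inj₂ i)))))))
    where
    header-bound : length header ≤ numeralBound (2 + (n + k))
      + (numeralBound m + (numeralBound widthBound + commonBound m k (gateCount (gates G)) * gateBound widthBound))
    header-bound =
      ≤-trans (≤-reflexive (trans (length-++ (encℕ (2 + (n + k)))) (cong (length (encℕ (2 + (n + k))) +_)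
          (trans (length-++ (encℕ m)) (cong (length (encℕ m) +_) (length-++ (encℕ (width common))))))))
        (+-mono-≤ (length-encℕ (2 + (n + k)))
          (+-mono-≤ (length-encℕ m)
            (+-mono-≤ (≤-trans (length-encℕ (width common)) (numeralBound-mono width-bound))
              (≤-trans (length-gatesPrefix width-bound (code common)) (*-monoˡ-≤ (gateBound widthBound) common-gates)))))

  length-shiftedCode-≡ : ∀ {J : Set} (p : Fin S → I) (q : Fin S → J) → length (shiftedCode p) ≡ length (shiftedCode q)
  length-shiftedCode-≡ p q =
    trans (length-++ (map inj₁ header))
      (trans (cong₂ _+_ (trans (length-map inj₁ header) (sym (length-map inj₁ header)))
          (trans (length-++ (choiceCode (n + k) S p))
            (trans (cong₂ _+_ (length-choiceCode-≡ S p q) (trans (length-map inj₁ footer) (sym (length-map inj₁ footer))))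
              (sym (length-++ (choiceCode (n + k) S q))))))
        (sym (length-++ (map inj₁ header))))

-- The adversary

lookup-injective : ∀ {u v : Vec X m} → lookup u ≗ lookup v → u ≡ v
lookup-injective {u = u} {v} eq = trans (sym (tabulate∘lookup u)) (trans (Vec-tabulate-cong eq) (tabulate∘lookup v))

does-true : ∀ {i j : Fin m} → does (i ≟ j) ≡ true → i ≡ j
does-true {i = i} {j} eq with i ≟ j
... | yes i≡j = i≡j

xnor⁻ : ∀ a b → not (a xor b) ≡ true → a ≡ b
xnor⁻ false false eq = refl
xnor⁻ true  true  eq = refl

xnor⁺ : ∀ {a b} → a ≡ b → not (a xor b) ≡ true
xnor⁺ {false} refl = refl
xnor⁺ {true}  refl = refl

∧⁻ : ∀ {a b} → a ∧ b ≡ true → a ≡ true × b ≡ true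
∧⁻ {true} eq = refl , eq

-- Each output bit needs one gate of `big`, a negation and two nested `⊕ᶠ`, the inner one around a
-- mask of at most 2k gates. The factors 2 arise because `⊕ᶠ` duplicates its operands.
verdictCost : ℕ → ℕ → ℕ
verdictCost m k = suc (m * suc (suc (5 + 2 * (5 + 2 * (k * 2)))))

module Adversary (M : NTM) (c : ℕ) {n m : ℕ} (G : Circuit n m) (k : ℕ) where
  open NTM M
  open Machine M
  open Tape M
  open Shifted G k

  -- The type of `shiftVar` depends on `T` and so on `L`; therefore `L` is measured with the
  -- labelling `id`, and `code-length` shows that the labelling does not affect it. The additional
  -- witness bit ensures that there is an input wire from which to form the constants.
  L T W witnessLength : ℕ
  L = length (shiftedCode {I = Fin S} id)
  T = c * L ^ c + c
  W = L + T
  witnessLength = suc (S + (k + T))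

  open Window W
  open WindowTape W

  Input : Set
  Input = Fin (m + witnessLength)

  targetVar : Fin m → Input
  targetVar i = i ↑ˡ witnessLength

  spareVar : Input
  spareVar = m ↑ʳ zero

  shiftVar : Fin S → Input
  shiftVar p = m ↑ʳ suc (p ↑ˡ (k + T))

  selectorVar : Fin k → Input
  selectorVar j = m ↑ʳ suc (S ↑ʳ (j ↑ˡ T))

  guessVar : Fin T → Input
  guessVar t = m ↑ʳ suc (S ↑ʳ (k ↑ʳ t))

  matches : Fin m → Formula (Input ⊎ CVar)
  matches i = neg (var (inj₁ (targetVar i)) ⊕ᶠ (lit (outputLit (toℕ i)) ⊕ᶠ maskFormula (inj₁ ∘ shiftVar) (inj₁ ∘ selectorVar) i))

  verdict : Formula (Input ⊎ CVar)
  verdict = var (inj₂ (st acceptSt)) ∧ᶠ big false matches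

  machineProgram : Program (m + witnessLength) (Bool ⊎ (Input ⊎ CVar))
  machineProgram = execProgram (tabulate guessVar) (initProgram (shiftedCode shiftVar) (inputs spareVar))

  verdictProgram : Program (m + witnessLength) (Bool ⊎ ((Input ⊎ CVar) ⊎ Fin 1))
  verdictProgram = extend (↔-id (Fin 1)) (λ _ → verdict) machineProgram

  adversary : NCircuit m
  adversary = ncircuit witnessLength (circuit _ (code verdictProgram) (wire verdictProgram (inj₂ (inj₂ zero)) ∷ []))

  code-length : length (shiftedCode shiftVar) ≡ L
  code-length = length-shiftedCode-≡ G k shiftVar id

  module _ (ρ : Input → Bool) where

    attacked : Circuit (2 + (n + k)) m
    attacked = shiftedCircuit (ρ ∘ shiftVar)

    shiftMask : Fin m → Bool
    shiftMask = mask (ρ ∘ shiftVar) (ρ ∘ selectorVar)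

    final : Config M
    final = exec M (initConf M (encCircuit attacked)) (tabulate (ρ ∘ guessVar))

    final-≡ : exec M (initial ρ (shiftedCode shiftVar)) (map ρ (tabulate guessVar)) ≡ final
    final-≡ = cong₂ (exec M) (cong (initConf M) (sym (shiftedCode-correct shiftVar ρ))) (map-tabulate guessVar ρ)

    exec-fits : ∀ γs {B} c → Fits B c → Fits (B + length γs) (exec M c (map ρ γs))
    exec-fits []       {B} c fit = subst (λ B → Fits B c) (sym (+-identityʳ B)) fit
    exec-fits (γ ∷ γs) {B} c fit =
      subst₂ Fits (sym (+-suc B (length γs))) (sym (exec-∷ c (ρ γ) (map ρ γs)))
        (exec-fits γs (advance c (ρ γ)) (advance-fits c (ρ γ) fit))

    room : length (shiftedCode shiftVar) + length (tabulate guessVar) ≡ W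
    room = cong₂ _+_ code-length (length-tabulate guessVar)

    final-fits : Fits W final
    final-fits = subst₂ Fits room final-≡
      (exec-fits (tabulate guessVar) (initial ρ (shiftedCode shiftVar)) (initial-fits ρ (shiftedCode shiftVar)))

    finalEnv : Input ⊎ CVar → Bool
    finalEnv = [ ρ , describe final ]

    matches-correct : ∀ (z : Vec Bool m) → output M final ≡ toList z → ∀ i →
                      ⟦ matches i ⟧ finalEnv ≡ not (ρ (targetVar i) xor (lookup z i xor shiftMask i))
    matches-correct z out i = cong not
      (trans (⟦⊕⟧ (var (inj₁ (targetVar i))) (lit (outputLit (toℕ i)) ⊕ᶠ maskFormula (inj₁ ∘ shiftVar) (inj₁ ∘ selectorVar) i)
              finalEnv)
        (cong (ρ (targetVar i) xor_)
          (trans (⟦⊕⟧ (lit (outputLit (toℕ i))) (maskFormula (inj₁ ∘ shiftVar) (inj₁ ∘ selectorVar) i) finalEnv)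
            (cong₂ _xor_ (outputLit-correct ρ final final-fits z out i)
                         (⟦mask⟧ (inj₁ ∘ shiftVar) (inj₁ ∘ selectorVar) i finalEnv)))))

    -- This has to come without any assumption on the output: only after acceptance is known does
    -- the correctness of `M` provide the z that `verdict-matches` presupposes.
    verdict-accepts : ⟦ verdict ⟧ finalEnv ≡ true → Config.state final ≡ acceptSt
    verdict-accepts eq = sym (does-true (proj₁ (∧⁻ eq)))

    verdict-matches : ∀ (z : Vec Bool m) → output M final ≡ toList z → ⟦ verdict ⟧ finalEnv ≡ true →
                      ∀ i → ρ (targetVar i) ≡ lookup z i xor shiftMask i
    verdict-matches z out eq i = xnor⁻ _ _ (trans (sym (matches-correct z out i))
      (reduce-∧⁻ (trans (sym (⟦big⟧ false matches finalEnv)) (proj₂ (∧⁻ {a = does (acceptSt ≟ Config.state final)} eq))) i))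

    verdict-intro : ∀ (z : Vec Bool m) → output M final ≡ toList z → Config.state final ≡ acceptSt →
                    (∀ i → ρ (targetVar i) ≡ lookup z i xor shiftMask i) → ⟦ verdict ⟧ finalEnv ≡ true
    verdict-intro z out acc eq = cong₂ _∧_ (dec-true (acceptSt ≟ Config.state final) (sym acc))
      (trans (⟦big⟧ false matches finalEnv) (reduce-∧⁺ λ i → trans (matches-correct z out i) (xnor⁺ (eq i))))

  adversary-run : ∀ x → Vec.head (eval (body adversary) x) ≡ ⟦ verdict ⟧ (finalEnv (lookup x))
  adversary-run x = extend-yields (↔-id (Fin 1)) (λ _ → verdict) machineProgram machine-yields (inj₂ (inj₂ zero))
    where
    ρ = lookup x
    machine-yields : Yields machineProgram x (finalEnv ρ)
    machine-yields = subst (λ c → Yields machineProgram x [ ρ , describe c ]) (final-≡ ρ)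
      (execProgram-yields (tabulate guessVar) (initProgram (shiftedCode shiftVar) (inputs spareVar))
        (initial ρ (shiftedCode shiftVar)) (initial-fits ρ (shiftedCode shiftVar)) (≤-reflexive (room ρ))
        (initProgram-yields (shiftedCode shiftVar) (inputs spareVar) (inputs-yields spareVar x)))

  flatten : (Fin k → Vec Bool m) → Fin S → Bool
  flatten s p = uncurry (λ j i → lookup (s j) i) (remQuot m p)

  Avoids : Set
  Avoids = ∀ s → (∃ λ g → AcceptsPath M (encCircuit (shiftedCircuit s)) g)
                 × (∀ g → AcceptsPath M (encCircuit (shiftedCircuit s)) g
                        → AvoidSolution (shiftedCircuit s) (PathOutput M (encCircuit (shiftedCircuit s)) g))

  xor-move : ∀ a b d → a ≡ b xor d → a xor d ≡ b
  xor-move _ false false refl = refl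
  xor-move _ false true  refl = refl
  xor-move _ true  false refl = refl
  xor-move _ true  true  refl = refl

  -- Acceptance of G(x) means G(x) = z ⊕ mask, so z = G(x) ⊕ mask is the value of the attacked
  -- circuit at false, true, x and the selectors of the witness, although `M` has output z as a
  -- string outside its range.
  module Soundness (avoids : Avoids) (x : Vec Bool n) (v : Vec Bool witnessLength)
                   (accepting : Vec.head (eval (body adversary) (eval G x Vec.++ v)) ≡ true) where

    ρ : Input → Bool
    ρ = lookup (eval G x Vec.++ v)

    verdict-true : ⟦ verdict ⟧ (finalEnv ρ) ≡ true
    verdict-true = trans (sym (adversary-run (eval G x Vec.++ v))) accepting

    solution : AvoidSolution (attacked ρ) (output M (final ρ))
    solution = proj₂ (avoids (ρ ∘ shiftVar)) (tabulate (ρ ∘ guessVar)) (verdict-accepts ρ verdict-true)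

    z : Vec Bool m
    z = proj₁ solution

    selectors : Vec Bool k
    selectors = Vec.tabulate (ρ ∘ selectorVar)

    preimage : Vec Bool (2 + (n + k))
    preimage = false ∷ true ∷ (x Vec.++ selectors)

    target : ∀ i → lookup (eval G x) i ≡ lookup z i xor shiftMask ρ i
    target i = trans (sym (lookup-++ˡ (eval G x) v i)) (verdict-matches ρ z (sym (proj₁ (proj₂ solution))) verdict-true i)

    hit : ∀ i → lookup (eval (attacked ρ) preimage) i ≡ lookup z i
    hit i = trans (shiftedCircuit-eval (ρ ∘ shiftVar) x selectors i)
      (trans (cong (lookup (eval G x) i xor_) (mask-cong {k} {m} {s = ρ ∘ shiftVar} (λ _ → refl) (lookup∘tabulate (ρ ∘ selectorVar)) i))
        (xor-move (lookup (eval G x) i) (lookup z i) (shiftMask ρ i) (target i)))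

    absurd : ⊥
    absurd = proj₂ (proj₂ solution) (preimage , lookup-injective hit)

  rejects-range : Avoids → ∀ x → accepts adversary (eval G x) ≡ false
  rejects-range avoids x =
    anyL-none (λ v → Vec.head (eval (body adversary) (eval G x Vec.++ v)))
      (λ v → ¬-not (Soundness.absurd avoids x v)) (allVecs witnessLength)

  module Witness (s : Fin k → Vec Bool m) (z : Vec Bool m) (f : Fin T → Bool) (j : Fin k) where

    selectors : Vec Bool k
    selectors = Vec.tabulate (λ j′ → does (j′ ≟ j))

    shifts guesses : Vec Bool _
    shifts  = Vec.tabulate (flatten s)
    guesses = Vec.tabulate f

    witness : Vec Bool witnessLength
    -- The leading bit is the one read by `spareVar`; either value yields the constants.
    witness = false ∷ (shifts Vec.++ (selectors Vec.++ guesses))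

    ρ : Input → Bool
    ρ = lookup ((z ⊕ s j) Vec.++ witness)

    ρ-witness : ∀ i → ρ (m ↑ʳ suc i) ≡ lookup (shifts Vec.++ (selectors Vec.++ guesses)) i
    ρ-witness i = lookup-++ʳ (z ⊕ s j) witness (suc i)

    shifts-≗ : ρ ∘ shiftVar ≗ flatten s
    shifts-≗ p = trans (ρ-witness (p ↑ˡ (k + T)))
      (trans (lookup-++ˡ shifts (selectors Vec.++ guesses) p) (lookup∘tabulate (flatten s) p))

    selectors-≗ : ∀ j′ → ρ (selectorVar j′) ≡ does (j′ ≟ j)
    selectors-≗ j′ = trans (ρ-witness (S ↑ʳ (j′ ↑ˡ T)))
      (trans (lookup-++ʳ shifts (selectors Vec.++ guesses) (j′ ↑ˡ T))
        (trans (lookup-++ˡ selectors guesses j′) (lookup∘tabulate (λ j′ → does (j′ ≟ j)) j′)))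

    guesses-≗ : ρ ∘ guessVar ≗ f
    guesses-≗ t = trans (ρ-witness (S ↑ʳ (k ↑ʳ t)))
      (trans (lookup-++ʳ shifts (selectors Vec.++ guesses) (k ↑ʳ t))
        (trans (lookup-++ʳ selectors guesses t) (lookup∘tabulate f t)))

    simulatedRun : Config M
    simulatedRun = exec M (initConf M (encCircuit (shiftedCircuit (flatten s)))) (tabulate f)

    final-run : final ρ ≡ simulatedRun
    final-run = cong₂ (λ C fs → exec M (initConf M (encCircuit C)) fs)
      (shiftedCircuit-cong shifts-≗) (tabulate-cong guesses-≗)

    shiftMask-≡ : ∀ i → shiftMask ρ i ≡ lookup (s j) i
    shiftMask-≡ i = trans (mask-cong {k} {m} shifts-≗ selectors-≗ i)
      (trans (reduce-at j (λ j′ → flatten s (combine j′ i)))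
        (cong (uncurry (λ j i → lookup (s j) i)) (remQuot-combine j i)))

    accepted : output M simulatedRun ≡ toList z → Config.state simulatedRun ≡ acceptSt → accepts adversary (z ⊕ s j) ≡ true
    accepted out acc = anyL-allVecs (λ v → Vec.head (eval (body adversary) ((z ⊕ s j) Vec.++ v))) witness
      (trans (adversary-run ((z ⊕ s j) Vec.++ witness))
        (verdict-intro ρ z (trans (cong (output M) final-run) out) (trans (cong Config.state final-run) acc) target))
      where
      target : ∀ i → ρ (targetVar i) ≡ lookup z i xor shiftMask ρ i
      target i = trans (lookup-++ˡ (z ⊕ s j) witness i)
        (trans (lookup-zipWith _xor_ i z (s j)) (cong (lookup z i xor_) (sym (shiftMask-≡ i))))

  module _ (halts-in-time : ∀ x g → length g ≡ c * length x ^ c + c → halted M (exec M (initConf M x) g) ≡ true)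
           (avoids : Avoids) where

    -- The run of `M` depends on s but not on j, so the same z and the same guesses serve all j;
    -- only the selectors in the witness change.
    accepts-shifts : (s : Fin k → Vec Bool m) → ∃ λ z → ∀ j → accepts adversary (z ⊕ s j) ≡ true
    accepts-shifts s = z , λ j → Witness.accepted s z f j
        (trans (cong (output M) f-run) (sym out))
        (trans (cong Config.state f-run) accepting)
      where
      x = encCircuit (shiftedCircuit (flatten s))

      x-length : length x ≡ L
      x-length = trans (cong length (shiftedCode-correct id (flatten s))) (length-map [ id , flatten s ] (shiftedCode id))

      g : List Bool
      g = proj₁ (proj₁ (avoids (flatten s)))

      accepting : AcceptsPath M x g
      accepting = proj₂ (proj₁ (avoids (flatten s)))

      solution : AvoidSolution (shiftedCircuit (flatten s)) (PathOutput M x g)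
      solution = proj₂ (avoids (flatten s)) g accepting

      z : Vec Bool m
      z = proj₁ solution

      out : toList z ≡ PathOutput M x g
      out = proj₁ (proj₂ solution)

      normalised : ∃ λ (f : Fin T → Bool) → exec M (initConf M x) (tabulate f) ≡ exec M (initConf M x) g
      normalised = exec-normalise (initConf M x) T
        (λ h len → halts-in-time x h (trans len (cong (λ l → c * l ^ c + c) (sym x-length))))
        g (accepting-halts (exec M (initConf M x) g) accepting)

      f : Fin T → Bool
      f = proj₁ normalised

      f-run : exec M (initConf M x) (tabulate f) ≡ exec M (initConf M x) g
      f-run = proj₂ normalised

    breaks : 2 ^ m < 3 ^ k → Breaks G adversary
    breaks large = dense , rejects-range avoids
      where
      module Escape (small : 3 * countL (accepts adversary) (allVecs m) < 2 ^ m) where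
        sparse : 3 * total m (bit ∘ accepts adversary) ≤ 2 ^ m
        sparse = ≤-trans (≤-reflexive (cong (3 *_) (sym (countL-total m (accepts adversary))))) (<⇒≤ small)

        escaping : ∃ λ (s : Fin k → Vec Bool m) → ∀ z → ¬ (∀ j → accepts adversary (z ⊕ s j) ≡ true)
        escaping = Hitting.shifts-escape (accepts adversary) sparse k large

        absurd : ⊥
        absurd = proj₂ escaping (proj₁ (accepts-shifts (proj₁ escaping))) (proj₂ (accepts-shifts (proj₁ escaping)))

      dense : 2 ^ m ≤ 3 * countL (accepts adversary) (allVecs m)
      dense = ≮⇒≥ Escape.absurd

-- The size of the adversary

module _ (M : NTM) (c : ℕ) where
  open NTM M
  open Machine.Window M using (#CVar)

  timeBound : ℕ → ℕ
  timeBound ℓ = c * ℓ ^ c + c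

  timeBound-mono : ∀ {ℓ ℓ′} → ℓ ≤ ℓ′ → timeBound ℓ ≤ timeBound ℓ′
  timeBound-mono le = +-monoˡ-≤ c (*-monoʳ-≤ c (^-monoˡ-≤ c le))

  #CVar-mono : ∀ {W W′} → W ≤ W′ → #CVar W ≤ #CVar W′
  #CVar-mono le = +-monoʳ-≤ states (+-monoʳ-≤ (3 + extra) (+-mono-≤ (*-monoˡ-≤ (3 + extra) le) (*-monoˡ-≤ (3 + extra) le)))

  -- In order: target and witness bits; three gates for the constants, the initial configuration,
  -- the steps of the machine and the verdict; one output. It is a function of the code length `ℓ`
  -- so that, by monotonicity, the exact length can be replaced by the polynomial `codeBound`.
  adversaryBound : ℕ → ℕ → ℕ → ℕ
  adversaryBound m k ℓ =
    m + suc (k * m + (k + t)) + (3 + #CVar W * 4 + t * (#CVar W * tableCost states (3 + extra)) + 1 * verdictCost m k) + 1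
    where
    t = timeBound ℓ
    W = ℓ + t

  adversaryBound-mono : ∀ m k {ℓ ℓ′} → ℓ ≤ ℓ′ → adversaryBound m k ℓ ≤ adversaryBound m k ℓ′
  adversaryBound-mono m k {ℓ} {ℓ′} le =
    +-monoˡ-≤ 1 (+-mono-≤ (+-monoʳ-≤ m (s≤s (+-monoʳ-≤ (k * m) (+-monoʳ-≤ k t≤))))
      (+-monoˡ-≤ (1 * verdictCost m k) (+-mono-≤ (+-monoʳ-≤ 3 (*-monoˡ-≤ 4 W≤))
        (*-mono-≤ t≤ (*-monoˡ-≤ (tableCost states (3 + extra)) W≤)))))
    where
    t≤ = timeBound-mono le
    W≤ = #CVar-mono (+-mono-≤ le t≤)

  module _ {n m : ℕ} (G : Circuit n m) (k : ℕ) where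
    open Adversary M c G k
    open Machine M
    open Window W hiding (#CVar)
    open Tape M
    open WindowTape W
    open Shifted G k

    verdict-cost : cost verdict ≤ verdictCost m k
    verdict-cost = s≤s (big-cost false matches λ i → s≤s (≤-trans (≤-reflexive (⊕-cost (var (inj₁ (targetVar i))) (inner i)))
        (+-monoʳ-≤ 5 (*-monoʳ-≤ 2 (≤-trans (≤-reflexive (⊕-cost (lit (outputLit (toℕ i))) (masked i)))
          (+-monoʳ-≤ 5 (*-monoʳ-≤ 2 (maskFormula-cost (inj₁ ∘ shiftVar) (inj₁ ∘ selectorVar) i))))))))
      where
      masked inner : Fin m → Formula (Input ⊎ CVar)
      masked i = maskFormula (inj₁ ∘ shiftVar) (inj₁ ∘ selectorVar) i
      inner i = lit (outputLit (toℕ i)) ⊕ᶠ masked i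

    adversary-size : nsize adversary ≤ adversaryBound m k L
    adversary-size = +-monoˡ-≤ 1 (+-monoʳ-≤ (m + witnessLength)
      (≤-trans (extend-gates (↔-id (Fin 1)) (λ _ → verdict) machineProgram (λ _ → verdict-cost))
        (+-monoˡ-≤ (1 * verdictCost m k)
          (≤-trans (execProgram-gates (tabulate guessVar) (initProgram (shiftedCode shiftVar) (inputs spareVar)))
            (+-mono-≤ (extend-gates enumeration (initFormula (shiftedCode shiftVar)) (inputs spareVar)
                        (initFormula-cost (shiftedCode shiftVar)))
                      (≤-reflexive (cong (_* (#CVar W * tableCost states (3 + extra))) (length-tabulate guessVar))))))))

-- The family of adversaries and the contradiction

module Family (G : (n : ℕ) → Circuit n (10 * n)) (M : NTM) (c : ℕ) where
  open NTM M

  shifts : ℕ → ℕ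
  shifts n = 7 * n

  attack : ∀ n → NCircuit (10 * n)
  attack n = Adversary.adversary M c (G n) (shifts n)

  -- Fills the lengths that are not multiples of ten, where nothing has to be broken. Its witness
  -- bit provides a wire to output even for N = 0.
  trivial : ∀ N → NCircuit N
  trivial N = ncircuit 1 (circuit (N + 1) [] ((N ↑ʳ zero) ∷ []))

  -- With the decision as an argument, matching on `refl` turns N into 10 * n, so that no adversary
  -- has to be transported along an equality of lengths.
  pick : ∀ N n → Dec (N ≡ 10 * n) → NCircuit N
  pick .(10 * n) n (yes refl) = attack n
  pick N         n (no _)     = trivial N

  family : ∀ N → NCircuit N
  family N = pick N (N / 10) (N ≟ℕ 10 * (N / 10))

  family-attack : ∀ n → family (10 * n) ≡ attack n
  family-attack n = at (10 * n / 10) (10 * n ≟ℕ 10 * (10 * n / 10)) (trans (cong (_/ 10) (*-comm 10 n)) (m*n/n≡m n 10))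
    where
    -- The quotient is generalised to a variable, so that its equality with n can be matched by
    -- `refl`.
    at : ∀ n′ (d : Dec (10 * n ≡ 10 * n′)) → n′ ≡ n → pick (10 * n) n′ d ≡ attack n
    at n′ (yes refl) refl = refl
    at n′ (no ≢)     refl = contradiction refl ≢

  module _ (G-poly : PolyBounded (λ n → size (G n))) where

    generatorGates : ℕ → ℕ
    generatorGates n = gateCount (gates (G n))

    bound : ℕ → ℕ
    bound n = adversaryBound M c (10 * n) (shifts n) (codeBound n (10 * n) (shifts n) (generatorGates n))

    attack-size : ∀ n → nsize (attack n) ≤ bound n
    attack-size n = ≤-trans (adversary-size M c (G n) (shifts n))
      (adversaryBound-mono M c (10 * n) (shifts n) (length-shiftedCode (G n) (shifts n) id))

    pick-size : ∀ N n d → nsize (pick N n d) ≤ bound n + (N + 2)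
    pick-size .(10 * n) n (yes refl) = ≤-trans (attack-size n) (m≤m+n _ _)
    pick-size N         n (no _)     = ≤-trans (≤-reflexive (arith N)) (m≤n+m (N + 2) (bound n))
      where
      arith : ∀ N → N + 1 + 0 + 1 ≡ N + 2
      arith = solve-∀

    poly-generatorGates : Poly generatorGates
    poly-generatorGates = poly-≤ (λ n → ≤-trans (m≤n+m _ n) (m≤m+n _ _)) (polyBounded⇒poly G-poly)

    poly-numeral : ∀ {f} → Poly f → Poly (numeralBound ∘ f)
    poly-numeral p = poly-+ (poly-* (poly-const 2) p) (poly-const 2)

    poly-gateBound : ∀ {f} → Poly f → Poly (gateBound ∘ f)
    poly-gateBound p = poly-+ (poly-const 3) (poly-* (poly-const 2) (poly-numeral p))

    poly-m : Poly (10 *_)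
    poly-m = poly-* (poly-const 10) poly-id

    poly-k : Poly shifts
    poly-k = poly-* (poly-const 7) poly-id

    poly-common : Poly (λ n → commonBound (10 * n) (shifts n) (generatorGates n))
    poly-common = poly-+ (poly-+ (poly-const 3) poly-generatorGates)
      (poly-* poly-m (poly-+ (poly-const 5) (poly-* (poly-const 2) (poly-* poly-k (poly-const 2)))))

    poly-inputs : Poly (λ n → 2 + (n + shifts n))
    poly-inputs = poly-+ (poly-const 2) (poly-+ poly-id poly-k)

    poly-wire : Poly (λ n → wireBound n (10 * n) (shifts n) (generatorGates n))
    poly-wire = poly-+ (poly-+ (poly-* poly-k poly-m) poly-inputs) poly-common

    codeLength : ℕ → ℕ
    codeLength n = codeBound n (10 * n) (shifts n) (generatorGates n)

    poly-code : Poly codeLength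
    poly-code = poly-+
      (poly-+ (poly-numeral poly-inputs)
        (poly-+ (poly-numeral poly-m) (poly-+ (poly-numeral poly-wire) (poly-* poly-common (poly-gateBound poly-wire)))))
      (poly-+ (poly-+ (poly-const 1) (poly-* (poly-* poly-k poly-m) (poly-gateBound poly-wire)))
        (poly-* poly-m (poly-numeral poly-wire)))

    poly-time : Poly (λ n → timeBound M c (codeLength n))
    poly-time = poly-pow c poly-code

    poly-CVar : Poly (λ n → Machine.Window.#CVar M (codeLength n + timeBound M c (codeLength n)))
    poly-CVar = poly-+ (poly-const states) (poly-+ (poly-const (3 + extra)) (poly-+ cells cells))
      where
      cells = poly-* (poly-+ poly-code poly-time) (poly-const (3 + extra))

    poly-verdict : Poly (λ n → verdictCost (10 * n) (shifts n))
    poly-verdict = poly-+ (poly-const 1) (poly-* poly-m (poly-+ (poly-const 2)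
      (poly-+ (poly-const 5) (poly-* (poly-const 2)
        (poly-+ (poly-const 5) (poly-* (poly-const 2) (poly-* poly-k (poly-const 2))))))))

    poly-bound : Poly bound
    poly-bound = poly-+
      (poly-+ (poly-+ poly-m (poly-+ (poly-const 1) (poly-+ (poly-* poly-k poly-m) (poly-+ poly-k poly-time))))
        (poly-+ (poly-+ (poly-+ (poly-const 3) (poly-* poly-CVar (poly-const 4)))
                        (poly-* poly-time (poly-* poly-CVar (poly-const (tableCost states (3 + extra))))))
                (poly-* (poly-const 1) poly-verdict)))
      (poly-const 1)

    poly-/10 : ∀ {f} → Poly f → Poly (λ N → f (N / 10))
    poly-/10 (d , le) = d , λ N → ≤-trans (le (N / 10)) (^-monoˡ-≤ d (+-monoʳ-≤ 2 (m/n≤m N 10)))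

    family-poly : PolyBounded (λ N → nsize (family N))
    family-poly = poly⇒polyBounded (poly-≤ (λ N → pick-size N (N / 10) (N ≟ℕ 10 * (N / 10)))
      (poly-+ (poly-/10 poly-bound) (poly-+ poly-id (poly-const 2))))

-- 2 ^ 10 = 1024 and 3 ^ 7 = 2187 = 1025 + 1162.
many-shifts : ∀ n → 2 ≤ n → 2 ^ (10 * n) < 3 ^ (7 * n)
many-shifts n@(suc _) _ = subst₂ _<_ (^-*-assoc 2 10 n) (^-*-assoc 3 7 n) (^-monoˡ-< n (m≤m+n 1025 1162))

stretching : ∀ n → 2 ≤ n → 2 + (n + 7 * n) < 10 * n
stretching n 2≤n = begin
  3 + (n + 7 * n)     ≤⟨ +-monoˡ-≤ (n + 7 * n) (≤-trans (m≤m+n 3 1) (*-monoʳ-≤ 2 2≤n)) ⟩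
  2 * n + (n + 7 * n) ≡⟨ arith n ⟩
  10 * n              ∎
  where
  open ≤-Reasoning
  arith : ∀ n → 2 * n + (n + 7 * n) ≡ 10 * n
  arith = solve-∀

family-breaks : ∀ (G : (n : ℕ) → Circuit n (10 * n)) (search : AvoidInSearchNP) →
                let M = proj₁ search ; c = proj₁ (proj₁ (proj₂ search)) in
                ∀ n → 2 ≤ n → Breaks (G n) (Family.family G M c (10 * n))
family-breaks G (M , (c , halts-in-time) , avoids) n 2≤n =
  subst (Breaks (G n)) (sym (Family.family-attack G M c n))
    (Adversary.breaks M c (G n) (7 * n) halts-in-time avoided (many-shifts n 2≤n))
  where
  avoided : Adversary.Avoids M c (G n) (7 * n)
  avoided s = avoids (2 + (n + 7 * n)) (10 * n) (Shifted.shiftedCircuit (G n) (7 * n) s) (stretching n 2≤n)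

theorem1p1 : (∃ λ (G : (n : ℕ) → Circuit n (10 * n)) → DemiBitsGenerator G)
    → ¬ AvoidInSearchNP
theorem1p1 (G , G-poly , secure) search = refute (secure D (Family.family-poly G M exponent G-poly))
  where
  M = proj₁ search
  exponent = proj₁ (proj₁ (proj₂ search))

  D : (N : ℕ) → NCircuit N
  D = Family.family G M exponent

  refute : ¬ (∃ λ n₀ → ∀ n → n₀ ≤ n → ¬ Breaks (G n) (D (10 * n)))
  refute (n₀ , unbroken) = unbroken (2 + n₀) (m≤n+m n₀ 2) (family-breaks G search (2 + n₀) (m≤m+n 2 n₀))
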